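{- Let $\mathcal{D}=(D,<,\approx)$, where $D$ is an infinite set, $<$ is a strict total order on $D$, and $\approx$ is equality. Then the satisfiability problem for $\mathrm{CLRV}^{\mathrm{XF},\mathrm{XF}^{ -1},\mathrm{int}}(\mathcal{D})$ is undecidable.
   Context: The variable set is $V=V_{\mathrm{local}}\uplus V_{\mathrm{remote}}$, a disjoint union of local and remote variables. $\mathrm{CLRV}^{\mathrm{XF},\mathrm{XF}^{ -1},\mathrm{int}}(\mathcal{D})$ formulas are given by the grammar $\phi ::= x_{loc}\approx \mathbf{X}^i y_{loc} \mid x_{loc}< \mathbf{X}^i y_{loc} \mid x_{rem}\approx \mathbf{X}^i y_{rem} \mid x_{rem}\approx \mathbf{XF}\, y_{rem} \mid x_{rem}\approx \mathbf{XF}^{ -1} y_{rem} \mid x_{loc}\approx y_{rem} \mid \phi\wedge\phi \mid \neg\phi \mid \mathbf{X}\phi \mid \phi\mathbf{U}\phi \mid \mathbf{X}^{ -1}\phi \mid \phi\mathbf{S}\phi$. Here $x_{loc},y_{loc}\in V_{\mathrm{local}}$, $x_{rem},y_{rem}\in V_{\mathrm{remote}}$ and $i\in\mathbb{N}$. A model is an infinite sequence $\sigma$ of maps $V\to D$, with the following semantics. - $\sigma,i\models x\approx\mathbf{X}^jy$ iff $\sigma(i)(x)=\sigma(i+j)(y)$. - $\sigma,i\models x<\mathbf{X}^jy$ iff $\sigma(i)(x)<\sigma(i+j)(y)$. - $\sigma,i\models x\approx\mathbf{XF}y$ iff there is $j>i$ with $\sigma(i)(x)=\sigma(j)(y)$.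 - $\sigma,i\models x\approx\mathbf{XF}^{ -1}y$ iff there is $0\le j<i$ with $\sigma(i)(x)=\sigma(j)(y)$. - $\sigma,i\models x_{loc}\approx y_{rem}$ iff $\sigma(i)(x_{loc})=\sigma(i)(y_{rem})$; this is an equality between a local and a remote variable at the same position. - Boolean connectives and $\mathbf{X},\mathbf{U}$ are as in LTL. - $\sigma,i\models\mathbf{X}^{ -1}\phi$ iff $i\ge1$ and $\sigma,i-1\models\phi$. - $\sigma,i\models\phi\mathbf{S}\phi'$ iff there is $j\le i$ with $\sigma,j\models\phi'$ and $\sigma,k\models\phi$ for all $j<k\le i$. The satisfiability problem asks, given a formula $\phi$, whether some model $\sigma$ satisfies $\sigma,0\models\phi$. -}

module Defs where

open import Data.Empty using (⊥-elim)
open import Data.Fin.Base using (Fin; zero; suc)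
open import Data.List.Base using (List)
open import Data.List.Membership.Propositional using (_∈_)
open import Data.Maybe.Base using (Maybe; just; nothing)
open import Data.Nat.Base using (ℕ; zero; suc; pred; _+_; _*_; _^_; _≤_; _<_)
open import Data.Nat.Properties using (*-assoc; *-cancelˡ-≡; *-identityˡ; even≢odd; suc-injective)
open import Data.Product.Base using (Σ; ∃; _×_; _,_; proj₁; proj₂)
open import Data.Sum.Base using (_⊎_; inj₁; inj₂)
open import Data.Vec.Base using (Vec; _∷_; head; lookup; replicate; _[_]≔_; _[_]%=_)
open import Level using (Level; Lift; _⊔_)
open import Relation.Binary.Core using (Rel)
open import Relation.Binary.PropositionalEquality using (_≡_; refl; sym; trans; cong; cong₂)
open import Relation.Nullary.Negation.Core using (¬_)

-- Both kinds of variables are drawn from a countably infinite supply.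
LocalVar RemoteVar Var : Set
LocalVar  = ℕ
RemoteVar = ℕ
Var       = LocalVar ⊎ RemoteVar

infix  8 _≈X[_]ˡ_ _<X[_]ˡ_ _≈X[_]ʳ_ _≈XFʳ_ _≈XF⁻¹ʳ_ _≈ˡʳ_
infix  7 ¬'_ X_ X⁻¹_
infixr 6 _U_ _S_
infixr 5 _∧'_

data Formula : Set where
  _≈X[_]ˡ_ : LocalVar → ℕ → LocalVar → Formula
  _<X[_]ˡ_ : LocalVar → ℕ → LocalVar → Formula
  _≈X[_]ʳ_ : RemoteVar → ℕ → RemoteVar → Formula
  _≈XFʳ_   : RemoteVar → RemoteVar → Formula
  _≈XF⁻¹ʳ_ : RemoteVar → RemoteVar → Formula
  _≈ˡʳ_    : LocalVar → RemoteVar → Formula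
  _∧'_     : Formula → Formula → Formula
  ¬'_      : Formula → Formula
  X_       : Formula → Formula
  _U_      : Formula → Formula → Formula
  X⁻¹_     : Formula → Formula
  _S_      : Formula → Formula → Formula

module Semantics {a ℓ : Level} (D : Set a) (_<ᴰ_ : Rel D ℓ) where

  Model : Set a
  Model = ℕ → Var → D

  infix 3 _,_⊨_

  -- The uses of Lift only align universe levels.
  _,_⊨_ : Model → ℕ → Formula → Set (a ⊔ ℓ)
  σ , i ⊨ x ≈X[ j ]ˡ y = Lift (a ⊔ ℓ) (σ i (inj₁ x) ≡ σ (i + j) (inj₁ y))
  σ , i ⊨ x <X[ j ]ˡ y = Lift (a ⊔ ℓ) (σ i (inj₁ x) <ᴰ σ (i + j) (inj₁ y))
  σ , i ⊨ x ≈X[ j ]ʳ y = Lift (a ⊔ ℓ) (σ i (inj₂ x) ≡ σ (i + j) (inj₂ y))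
  σ , i ⊨ x ≈XFʳ y     = Lift (a ⊔ ℓ) (∃ λ j → i < j × σ i (inj₂ x) ≡ σ j (inj₂ y))
  σ , i ⊨ x ≈XF⁻¹ʳ y   = Lift (a ⊔ ℓ) (∃ λ j → j < i × σ i (inj₂ x) ≡ σ j (inj₂ y))
  σ , i ⊨ x ≈ˡʳ y      = Lift (a ⊔ ℓ) (σ i (inj₁ x) ≡ σ i (inj₂ y))
  σ , i ⊨ φ ∧' ψ       = (σ , i ⊨ φ) × (σ , i ⊨ ψ)
  σ , i ⊨ ¬' φ         = ¬ (σ , i ⊨ φ)
  σ , i ⊨ X φ          = σ , suc i ⊨ φ
  σ , i ⊨ φ U ψ        = ∃ λ j → i ≤ j × (σ , j ⊨ ψ) × (∀ k → i ≤ k → k < j → σ , k ⊨ φ)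
  σ , i ⊨ X⁻¹ φ        = 1 ≤ i × (σ , pred i ⊨ φ)
  σ , i ⊨ φ S ψ        = ∃ λ j → j ≤ i × (σ , j ⊨ ψ) × (∀ k → j < k → k ≤ i → σ , k ⊨ φ)

Satisfiable : {a ℓ : Level} (D : Set a) (_<ᴰ_ : Rel D ℓ) → Formula → Set (a ⊔ ℓ)
Satisfiable D _<ᴰ_ φ = ∃ λ (σ : Model) → σ , 0 ⊨ φ
  where open Semantics D _<ᴰ_

Infinite : {a : Level} → Set a → Set a
Infinite A = ¬ (∃ λ (xs : List A) → ∀ x → x ∈ xs)

-- Instructions of Minsky register machines; each names its successor states.
data Instr (regs states : ℕ) : Set where
  halt : Instr regs states
  inc  : Fin regs → Fin states → Instr regs states
  dec  : Fin regs → Fin states → Fin states → Instr regs states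

-- A machine has 1 + r registers and 1 + s states, the initial state being
-- zero; register zero holds both the input and the output.
record Machine : Set where
  field
    r s     : ℕ
    program : Vec (Instr (suc r) (suc s)) (suc s)

Config : Machine → Set
Config M = Fin (suc s) × Vec ℕ (suc r)
  where open Machine M

exec : ∀ {r s} → Instr r s → Vec ℕ r → Maybe (Fin s × Vec ℕ r)
exec halt          v = nothing
exec (inc x q)     v = just (q , v [ x ]%= suc)
exec (dec x q₀ q₊) v with lookup v x
... | zero  = just (q₀ , v)
... | suc n = just (q₊ , v [ x ]≔ n)

step : (M : Machine) → Config M → Maybe (Config M)
step M (q , v) = exec (lookup (Machine.program M) q) v

infix 3 _⊢_⇓_ _⟨_⟩⇓_

data _⊢_⇓_ (M : Machine) : Config M → ℕ → Set where
  done : ∀ {c} → step M c ≡ nothing → M ⊢ c ⇓ head (proj₂ c)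
  next : ∀ {c c' n} → step M c ≡ just c' → M ⊢ c' ⇓ n → M ⊢ c ⇓ n

_⟨_⟩⇓_ : Machine → ℕ → ℕ → Set
M ⟨ m ⟩⇓ n = M ⊢ (zero , m ∷ replicate (Machine.r M) 0) ⇓ n

-- No machine computes the characteristic function of P on codes.  Asking
-- for the two implications, rather than a decision of P x, is the weakest
-- constructive reading of a decider and so the strongest undecidability.
Undecidable : {a p : Level} {A : Set a} → (A → ℕ) → (A → Set p) → Set (a ⊔ p)
Undecidable code P =
  ¬ (Σ Machine λ M → ∀ x → (P x → M ⟨ code x ⟩⇓ 1) × (¬ P x → M ⟨ code x ⟩⇓ 0))

pair : ℕ → ℕ → ℕ
pair m n = 2 ^ m * suc (2 * n)

tag : Formula → ℕ
tag (_ ≈X[ _ ]ˡ _) = 0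
tag (_ <X[ _ ]ˡ _) = 1
tag (_ ≈X[ _ ]ʳ _) = 2
tag (_ ≈XFʳ _)     = 3
tag (_ ≈XF⁻¹ʳ _)   = 4
tag (_ ≈ˡʳ _)      = 5
tag (_ ∧' _)       = 6
tag (¬' _)         = 7
tag (X _)          = 8
tag (_ U _)        = 9
tag (X⁻¹ _)        = 10
tag (_ S _)        = 11

mutual
  code : Formula → ℕ
  code φ = pair (tag φ) (args φ)

  args : Formula → ℕ
  args (x ≈X[ i ]ˡ y) = pair x (pair i y)
  args (x <X[ i ]ˡ y) = pair x (pair i y)
  args (x ≈X[ i ]ʳ y) = pair x (pair i y)
  args (x ≈XFʳ y)     = pair x y
  args (x ≈XF⁻¹ʳ y)   = pair x y
  args (x ≈ˡʳ y)      = pair x y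
  args (φ ∧' ψ)       = pair (code φ) (code ψ)
  args (¬' φ)         = code φ
  args (X φ)          = code φ
  args (φ U ψ)        = pair (code φ) (code ψ)
  args (X⁻¹ φ)        = code φ
  args (φ S ψ)        = pair (code φ) (code ψ)

pair-injective : ∀ m n m' n' → pair m n ≡ pair m' n' → m ≡ m' × n ≡ n'
pair-injective zero n zero n' eq =
  refl , *-cancelˡ-≡ n n' 2 (suc-injective
    (trans (sym (*-identityˡ _)) (trans eq (*-identityˡ _))))
pair-injective zero n (suc m') n' eq =
  ⊥-elim (even≢odd (pair m' n') n
    (trans (sym (*-assoc 2 (2 ^ m') _)) (trans (sym eq) (*-identityˡ _))))
pair-injective (suc m) n zero n' eq =
  ⊥-elim (even≢odd (pair m n) n'
    (trans (sym (*-assoc 2 (2 ^ m) _)) (trans eq (*-identityˡ _))))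
pair-injective (suc m) n (suc m') n' eq
  with pair-injective m n m' n' (*-cancelˡ-≡ (pair m n) (pair m' n') 2
         (trans (sym (*-assoc 2 (2 ^ m) _)) (trans eq (*-assoc 2 (2 ^ m') _))))
... | refl , refl = refl , refl

mutual
  code-injective : ∀ φ ψ → code φ ≡ code ψ → φ ≡ ψ
  code-injective φ ψ eq with pair-injective (tag φ) (args φ) (tag ψ) (args ψ) eq
  ... | t , e = args-injective φ ψ t e

  args-injective : ∀ φ ψ → tag φ ≡ tag ψ → args φ ≡ args ψ → φ ≡ ψ
  args-injective (x ≈X[ i ]ˡ y) (x' ≈X[ i' ]ˡ y') refl e with pair-injective x _ x' _ e
  ... | refl , e' with pair-injective i y i' y' e'
  ...   | refl , refl = refl
  args-injective (x <X[ i ]ˡ y) (x' <X[ i' ]ˡ y') refl e with pair-injective x _ x' _ e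
  ... | refl , e' with pair-injective i y i' y' e'
  ...   | refl , refl = refl
  args-injective (x ≈X[ i ]ʳ y) (x' ≈X[ i' ]ʳ y') refl e with pair-injective x _ x' _ e
  ... | refl , e' with pair-injective i y i' y' e'
  ...   | refl , refl = refl
  args-injective (x ≈XFʳ y) (x' ≈XFʳ y') refl e with pair-injective x y x' y' e
  ... | refl , refl = refl
  args-injective (x ≈XF⁻¹ʳ y) (x' ≈XF⁻¹ʳ y') refl e with pair-injective x y x' y' e
  ... | refl , refl = refl
  args-injective (x ≈ˡʳ y) (x' ≈ˡʳ y') refl e with pair-injective x y x' y' e
  ... | refl , refl = refl
  args-injective (φ ∧' ψ) (φ' ∧' ψ') refl e with pair-injective (code φ) (code ψ) (code φ') (code ψ') e
  ... | e₁ , e₂ = cong₂ _∧'_ (code-injective φ φ' e₁) (code-injective ψ ψ' e₂)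
  args-injective (¬' φ) (¬' φ') refl e = cong ¬'_ (code-injective φ φ' e)
  args-injective (X φ) (X φ') refl e = cong X_ (code-injective φ φ' e)
  args-injective (φ U ψ) (φ' U ψ') refl e with pair-injective (code φ) (code ψ) (code φ') (code ψ') e
  ... | e₁ , e₂ = cong₂ _U_ (code-injective φ φ' e₁) (code-injective ψ ψ' e₂)
  args-injective (X⁻¹ φ) (X⁻¹ φ') refl e = cong X⁻¹_ (code-injective φ φ' e)
  args-injective (φ S ψ) (φ' S ψ') refl e with pair-injective (code φ) (code ψ) (code φ') (code ψ') e
  ... | e₁ , e₂ = cong₂ _S_ (code-injective φ φ' e₁) (code-injective ψ ψ' e₂)

{-# OPTIONS --safe #-}

-- A counter is a queue of data values: the local variables pushed and popped
-- hold the value pushed last and popped last, both are nondecreasing in time,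
-- and their remote copies force both to run through the same set of values.
-- Then a strict increase of either variable is always a move to the very next
-- value of that set, so increment, decrement and zero test (pushed ≈ popped)
-- are exact, and a formula can follow the run of a register machine.
--
-- Given a machine M deciding satisfiability, let φ say: load the number n
-- marked by the conjunct target ≈ Xⁿ pushed, compute from it the code of
-- φ ∧ (target ≈ Xⁿ pushed) under the assumption n = code φ, run M on that
-- code, and if M halts, its output is 0.  With n = code φ the conjunction is
-- satisfiable if M outputs 0 on its code, and unsatisfiable if M outputs 1.
module Submission where

open import Defs
open import Level using (Level; lift; lower)
open import Relation.Binary.Core using (Rel)
open import Relation.Binary.PropositionalEquality using (_≡_; _≢_; refl; sym; trans; cong; cong₂; subst; subst₂)
open import Relation.Binary.Structures using (IsStrictTotalOrder)
open import Data.Bool.Base using (if_then_else_)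
open import Data.Fin.Base using (Fin; zero; suc; toℕ)
import Data.Fin.Properties as Fin
open import Data.List.Base using (List; []; _∷_; _++_; length)
open import Data.List.Membership.Propositional using (_∉_)
open import Data.List.Properties using (length-++)
open import Data.List.Relation.Unary.All using (All; []; _∷_)
open import Data.List.Relation.Unary.AllPairs using (AllPairs; []; _∷_)
open import Data.List.Relation.Unary.Any using (here; there; any?)
open import Data.Nat.Base using (ℕ; zero; suc; _+_; _*_; _^_; _∸_; _≤_; _<_; z≤n; s≤s; _≤′_; ≤′-refl; ≤′-step)
import Data.Nat.Properties as ℕ
open import Data.Nat.Tactic.RingSolver using (solve-∀)
open import Data.Product.Base using (∃; _×_; _,_; proj₁; proj₂)
open import Data.Sum.Base using (_⊎_; inj₁; inj₂)
open import Data.Unit.Base using (⊤; tt)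
open import Data.Vec.Base as Vec using (Vec; []; _∷_; lookup; replicate; _[_]≔_; _[_]%=_)
open import Data.Vec.Properties using (lookup-map; lookup∘updateAt; lookup∘updateAt′; lookup-replicate)
open import Function.Base using (_∘_; const; case_of_)
open import Relation.Binary.Definitions using (tri<; tri≈; tri>)
open import Relation.Nullary using (¬_; Dec; yes; no; does)
open import Relation.Nullary.Decidable using (decidable-stable)
open import Relation.Nullary.Negation using (contradiction)

-- Register programs

data Command (R : ℕ) : Set where
  incr : Fin R → ℕ → Command R
  decr : Fin R → ℕ → ℕ → Command R
  load : Fin R → ℕ → Command R
  stop : Fin R → Command R
  idle : Command R

fetch : ∀ {R} → List (Command R) → ℕ → Command R
fetch []       q       = idle
fetch (c ∷ cs) zero    = c
fetch (c ∷ cs) (suc q) = fetch cs q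

module _ {R : ℕ} (P : List (Command R)) where

  -- Being inductive, these are the halting runs. They start once loading is over, so `load` has no
  -- rule here; its positions are treated separately on both sides of the reduction.
  data Run (o : ℕ) : ℕ → Vec ℕ R → Set where
    stop  : ∀ {q v r} → fetch P q ≡ stop r → lookup v r ≡ o → Run o q v
    incr  : ∀ {q v r k} → fetch P q ≡ incr r k → Run o k (v [ r ]%= suc) → Run o q v
    decr₀ : ∀ {q v r k k'} → fetch P q ≡ decr r k k' → lookup v r ≡ 0 → Run o k v → Run o q v
    decr₊ : ∀ {q v r k k' m} → fetch P q ≡ decr r k k' → lookup v r ≡ suc m →
            Run o k' (v [ r ]≔ m) → Run o q v

  At : ℕ → List (Command R) → Set
  At a []       = ⊤
  At a (c ∷ cs) = fetch P a ≡ c × At (suc a) cs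

  At-++⁻ : ∀ a cs ds → At a (cs ++ ds) → At a cs × At (length cs + a) ds
  At-++⁻ a []       ds at       = tt , at
  At-++⁻ a (c ∷ cs) ds (e , at) with At-++⁻ (suc a) cs ds at
  ... | at₁ , at₂ = (e , at₁) , subst (λ b → At b ds) (ℕ.+-suc (length cs) a) at₂

fetch-end : ∀ {R} (cs : List (Command R)) → fetch cs (length cs) ≡ idle
fetch-end []       = refl
fetch-end (c ∷ cs) = fetch-end cs

At-suffix : ∀ {R} (P : List (Command R)) a cs → (∀ k → fetch P (k + a) ≡ fetch cs k) → At P a cs
At-suffix P a []       eq = tt
At-suffix P a (c ∷ cs) eq =
  eq 0 , At-suffix P (suc a) cs λ k → trans (cong (fetch P) (ℕ.+-suc k a)) (eq (suc k))

At-self : ∀ {R} (P : List (Command R)) → At P 0 P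
At-self P = At-suffix P 0 P λ k → cong (fetch P) (ℕ.+-identityʳ k)

At-fetch : ∀ {R} {P : List (Command R)} {n} a (cs : Vec (Command R) n) → At P a (Vec.toList cs) →
           ∀ q → fetch P (toℕ q + a) ≡ lookup cs q
At-fetch a (c ∷ cs) (e , at) zero    = e
At-fetch {P = P} a (c ∷ cs) (e , at) (suc q) =
  trans (cong (fetch P) (sym (ℕ.+-suc (toℕ q) a))) (At-fetch (suc a) cs at q)

-- Structured programs and their compilation

infixr 4 _⨾_

data Prog (R : ℕ) : Set where
  inc  : Fin R → Prog R
  _⨾_  : Prog R → Prog R → Prog R
  -- while the register is positive: decrement it, then run the body
  loop : Fin R → Prog R → Prog R

size : ∀ {R} → Prog R → ℕ
size (inc r)    = 1
size (p ⨾ q)    = size p + size q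
size (loop r p) = suc (size p)

-- The code of a program placed at address a and leaving to address k.
compile : ∀ {R} → ℕ → Prog R → ℕ → List (Command R)
compile a (inc r)    k = incr r k ∷ []
compile a (p ⨾ q)    k = compile a p (size p + a) ++ compile (size p + a) q k
compile a (loop r p) k = decr r k (suc a) ∷ compile (suc a) p a

length-compile : ∀ {R} a (p : Prog R) k → length (compile a p k) ≡ size p
length-compile a (inc r)    k = refl
length-compile a (p ⨾ q)    k =
  trans (length-++ (compile a p (size p + a)))
        (cong₂ _+_ (length-compile a p (size p + a)) (length-compile (size p + a) q k))
length-compile a (loop r p) k = cong suc (length-compile (suc a) p a)

infix 3 _⊢_⇝_

-- Correctness in continuation form, for every placement of the code: whatever run starts at the
-- exit can be extended backwards to the entry. Sequencing then becomes composition.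
record _⊢_⇝_ {R} (p : Prog R) (v v' : Vec ℕ R) : Set where
  field prepend : ∀ {P a k o} → At P a (compile a p k) → Run P o k v' → Run P o a v

open _⊢_⇝_ public

⇝-inc : ∀ {R} {r : Fin R} {v} → inc r ⊢ v ⇝ v [ r ]%= suc
⇝-inc .prepend (e , _) run = incr e run

infixr 4 _⇝-⨾_

_⇝-⨾_ : ∀ {R} {p q : Prog R} {u v w} → p ⊢ u ⇝ v → q ⊢ v ⇝ w → p ⨾ q ⊢ u ⇝ w
_⇝-⨾_ {p = p} {q} p⇝ q⇝ .prepend {P} {a} {k} at run
  with At-++⁻ P a (compile a p (size p + a)) (compile (size p + a) q k) at
... | at₁ , at₂ rewrite length-compile a p (size p + a) = p⇝ .prepend at₁ (q⇝ .prepend at₂ run)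

⇝-loop₀ : ∀ {R} {r : Fin R} {p v} → lookup v r ≡ 0 → loop r p ⊢ v ⇝ v
⇝-loop₀ z .prepend (e , _) run = decr₀ e z run

⇝-loop₊ : ∀ {R} {r : Fin R} {p v u w m} → lookup v r ≡ suc m →
          p ⊢ v [ r ]≔ m ⇝ u → loop r p ⊢ u ⇝ w → loop r p ⊢ v ⇝ w
⇝-loop₊ s p⇝ l⇝ .prepend at@(e , at') run = decr₊ e s (p⇝ .prepend at' (l⇝ .prepend at run))

-- Computing the code of the diagonal formula

abstract
  -- The code of φ ∧' numeral n when n is the code of φ; it is abstract since
  -- its unfolding would be compared in unary notation.
  diagonalCode : ℕ → ℕ
  diagonalCode n = pair 6 (pair n (pair 0 (pair 2 (pair n 0))))

  diagonalCode-≡ : ∀ n → pair 6 (pair n (pair 0 (pair 2 (pair n 0)))) ≡ diagonalCode n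
  diagonalCode-≡ n = refl

-- Registers 0–4 are: the loaded number, a copy of it, the exponent of a
-- pairing, a temporary, and junk; the registers of M follow.
pattern #n = zero
pattern #c = suc zero
pattern #e = suc (suc zero)
pattern #t = suc (suc (suc zero))
pattern #j = suc (suc (suc (suc zero)))
pattern #M x = suc (suc (suc (suc (suc x))))

module _ {r : ℕ} where

  private
    R = 6 + r

  double pairing : Prog R
  double  = loop (#M zero) (inc #t ⨾ inc #t) ⨾ loop #t (inc (#M zero))
  pairing = double ⨾ inc (#M zero) ⨾ loop #e double

  -- Evaluates the nested pairs of `diagonalCode` from the inside out: `#M zero` holds the value so
  -- far, and `#e` the next left component, which each `pairing` uses up. The copy in `#c` serves
  -- the second occurrence of the loaded number.
  diagonal : Prog R
  diagonal =
      loop #n (inc #c ⨾ inc #e) ⨾ pairing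
    ⨾ inc #e ⨾ inc #e ⨾ pairing
    ⨾ pairing
    ⨾ loop #c (inc #e) ⨾ pairing
    ⨾ inc #e ⨾ inc #e ⨾ inc #e ⨾ inc #e ⨾ inc #e ⨾ inc #e ⨾ pairing

  module _ {j : ℕ} {w : Vec ℕ r} where

    double-⇝ : ∀ n c e x →
      double ⊢ n ∷ c ∷ e ∷ 0 ∷ j ∷ x ∷ w ⇝ n ∷ c ∷ e ∷ 0 ∷ j ∷ 2 * x ∷ w
    double-⇝ n c e x = out x 0 (ℕ.+-identityʳ _) ⇝-⨾ back (2 * x) 0 (ℕ.+-identityʳ _)
      where
      -- The final value is a variable tied by an equation, so that a recursive call only has to
      -- adjust the equation.
      out : ∀ x t {y} → 2 * x + t ≡ y → loop (#M zero) (inc #t ⨾ inc #t)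
            ⊢ n ∷ c ∷ e ∷ t ∷ j ∷ x ∷ w ⇝ n ∷ c ∷ e ∷ y ∷ j ∷ 0 ∷ w
      out zero    t refl = ⇝-loop₀ refl
      out (suc x) t eq   = ⇝-loop₊ refl (⇝-inc ⇝-⨾ ⇝-inc) (out x (2 + t) (trans (shift x t) eq))
        where
        shift : ∀ x t → 2 * x + (2 + t) ≡ 2 * suc x + t
        shift = solve-∀
      back : ∀ t x {y} → t + x ≡ y → loop #t (inc (#M zero))
             ⊢ n ∷ c ∷ e ∷ t ∷ j ∷ x ∷ w ⇝ n ∷ c ∷ e ∷ 0 ∷ j ∷ y ∷ w
      back zero    x refl = ⇝-loop₀ refl
      back (suc t) x eq   = ⇝-loop₊ refl ⇝-inc (back t (suc x) (trans (ℕ.+-suc t x) eq))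

    pairing-⇝ : ∀ n c e x →
      ∀ {y} → pair e x ≡ y → pairing ⊢ n ∷ c ∷ e ∷ 0 ∷ j ∷ x ∷ w ⇝ n ∷ c ∷ 0 ∷ 0 ∷ j ∷ y ∷ w
    pairing-⇝ n c e x eq = double-⇝ n c e x ⇝-⨾ ⇝-inc ⇝-⨾ power e (suc (2 * x)) eq
      where
      power : ∀ e x {y} → 2 ^ e * x ≡ y → loop #e double
              ⊢ n ∷ c ∷ e ∷ 0 ∷ j ∷ x ∷ w ⇝ n ∷ c ∷ 0 ∷ 0 ∷ j ∷ y ∷ w
      power zero    x refl rewrite ℕ.*-identityˡ x = ⇝-loop₀ refl
      power (suc e) x eq = ⇝-loop₊ refl (double-⇝ n c e x) (power e (2 * x) (trans (shift (2 ^ e) x) eq))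
        where
        shift : ∀ k x → k * (2 * x) ≡ 2 * k * x
        shift = solve-∀

    diagonal-⇝ : ∀ n →
      diagonal ⊢ n ∷ 0 ∷ 0 ∷ 0 ∷ j ∷ 0 ∷ w ⇝
                 0 ∷ 0 ∷ 0 ∷ 0 ∷ j ∷ diagonalCode n ∷ w
    diagonal-⇝ n =
         copy n 0 (ℕ.+-identityʳ n) ⇝-⨾ pairing-⇝ 0 n n 0 refl
      ⇝-⨾ ⇝-inc ⇝-⨾ ⇝-inc ⇝-⨾ pairing-⇝ 0 n 2 x₁ refl
      ⇝-⨾ pairing-⇝ 0 n 0 x₂ refl
      ⇝-⨾ move n 0 (ℕ.+-identityʳ n) ⇝-⨾ pairing-⇝ 0 0 n x₃ refl
      ⇝-⨾ ⇝-inc ⇝-⨾ ⇝-inc ⇝-⨾ ⇝-inc ⇝-⨾ ⇝-inc ⇝-⨾ ⇝-inc ⇝-⨾ ⇝-inc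
      ⇝-⨾ pairing-⇝ 0 0 6 x₄ (diagonalCode-≡ n)
      where
      x₁ = pair n 0
      x₂ = pair 2 x₁
      x₃ = pair 0 x₂
      x₄ = pair n x₃
      copy : ∀ n c {c' x} → n + c ≡ c' → loop #n (inc #c ⨾ inc #e)
             ⊢ n ∷ c ∷ c ∷ 0 ∷ j ∷ x ∷ w ⇝ 0 ∷ c' ∷ c' ∷ 0 ∷ j ∷ x ∷ w
      copy zero    c refl = ⇝-loop₀ refl
      copy (suc n) c eq   = ⇝-loop₊ refl (⇝-inc ⇝-⨾ ⇝-inc) (copy n (suc c) (trans (ℕ.+-suc n c) eq))
      move : ∀ c e {e' x} → c + e ≡ e' → loop #c (inc #e)
             ⊢ 0 ∷ c ∷ e ∷ 0 ∷ j ∷ x ∷ w ⇝ 0 ∷ 0 ∷ e' ∷ 0 ∷ j ∷ x ∷ w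
      move zero    e refl = ⇝-loop₀ refl
      move (suc c) e eq   = ⇝-loop₊ refl ⇝-inc (move c (suc e) (trans (ℕ.+-suc c e) eq))

-- Running a decider on the diagonal code

module Simulation (M : Machine) where

  open Machine M

  R : ℕ
  R = 6 + r

  base : ℕ
  base = size (diagonal {r}) + 2

  translate : Instr (suc r) (suc s) → Command R
  translate halt        = stop (#M zero)
  translate (inc x q)   = incr (#M x) (toℕ q + base)
  translate (dec x p q) = decr (#M x) (toℕ p + base) (toℕ q + base)

  -- Address 0 takes care of position 0, so that the load at address 1 runs
  -- during exactly the positions 1, …, n.
  body P : List (Command R)
  body = Vec.toList (Vec.map translate program)
  P    = incr #j 1 ∷ load #n 2 ∷ compile 2 diagonal base ++ body

  private
    at : At P 2 (compile 2 diagonal base) × At P (length (compile 2 (diagonal {r}) base) + 2) body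
    at = At-++⁻ P 2 (compile 2 diagonal base) body (proj₂ (proj₂ (At-self P)))

    at-base : At P base body
    at-base = subst (λ k → At P (k + 2) body) (length-compile 2 (diagonal {r}) base) (proj₂ at)

  fetch-program : ∀ q → fetch P (toℕ q + base) ≡ translate (lookup program q)
  fetch-program q = trans (At-fetch base (Vec.map translate program) at-base q)
                          (lookup-map q translate program)

  -- Each instruction becomes exactly one command on shifted registers and addresses, so both
  -- computations advance in lockstep.
  simulate : ∀ {o q v j} → M ⊢ (q , v) ⇓ o → Run P o (toℕ q + base) (0 ∷ 0 ∷ 0 ∷ 0 ∷ j ∷ v)
  simulate {q = q} {v} (done e) with lookup program q | fetch-program q
  simulate {v = x ∷ _} (done e)  | halt      | f = stop f refl
  simulate {v = v} (done e) | dec x _ _ | f with lookup v x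
  simulate (done ()) | dec x _ _ | f | zero
  simulate (done ()) | dec x _ _ | f | suc _
  simulate {q = q} {v} (next e run) with lookup program q | fetch-program q
  simulate (next refl run) | inc x q' | f = incr f (simulate run)
  simulate {v = v} (next e run) | dec x _ _ | f with lookup v x in eq
  simulate (next refl run) | dec x _ _ | f | zero  = decr₀ f eq (simulate run)
  simulate (next refl run) | dec x _ _ | f | suc m = decr₊ f eq (simulate run)

  simulate-diagonal : ∀ {n o} → M ⟨ diagonalCode n ⟩⇓ o →
                      Run P o 2 (n ∷ 0 ∷ 0 ∷ 0 ∷ 1 ∷ replicate (suc r) 0)
  simulate-diagonal {n} run = diagonal-⇝ n .prepend (proj₁ at) (simulate run)

-- The formulas

infixr 4 _⇒'_ _∨'_

-- Built from the negation and conjunction of the grammar, these are constructively weak: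
-- eliminating them yields doubly negated conclusions, hence the double negations in the reading of
-- models.
_⇒'_ _∨'_ : Formula → Formula → Formula
φ ⇒' ψ = ¬' (φ ∧' ¬' ψ)
φ ∨' ψ = ¬' (¬' φ ∧' ¬' ψ)

⊤' : Formula
⊤' = 0 ≈X[ 0 ]ˡ 0 ⇒' 0 ≈X[ 0 ]ˡ 0

□ : Formula → Formula
□ φ = ¬' (⊤' U ¬' φ)

⋀ : ∀ {n} → (Fin n → Formula) → Formula
⋀ {zero}  f = ⊤'
⋀ {suc n} f = f zero ∧' ⋀ (f ∘ suc)

-- Residues modulo 3 keep the three families disjoint, whatever the number of registers and states.
pushed popped extra : ℕ → LocalVar
pushed zero    = 0
pushed (suc k) = 3 + pushed k
popped zero    = 1
popped (suc k) = 3 + popped k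
extra zero     = 2
extra (suc k)  = 3 + extra k

target true : LocalVar
target = extra 0
true   = extra 1

data Action : Set where
  push pop keep : Action

only : ∀ {R} → Fin R → Action → Fin R → Action
only r a x = if does (x Fin.≟ r) then a else keep

only-≡ : ∀ {R} (r : Fin R) a → only r a r ≡ a
only-≡ r a with r Fin.≟ r
... | yes _  = refl
... | no r≢r = contradiction refl r≢r

only-≢ : ∀ {R} {r x : Fin R} a → x ≢ r → only r a x ≡ keep
only-≢ {r = r} {x} a x≢r with x Fin.≟ r
... | yes x≡r = contradiction x≡r x≢r
... | no _    = refl

same above : LocalVar → Formula
same x  = x ≈X[ 1 ]ˡ x
above x = x <X[ 1 ]ˡ x

-- A Boolean is encoded as equality with the reference variable `true`.
state : ℕ → Formula
state q = extra (2 + q) ≈X[ 0 ]ˡ true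

act : Action → ℕ → Formula
act push k = above (pushed k) ∧' same (popped k)
act pop  k = same (pushed k) ∧' above (popped k)
act keep k = same (pushed k) ∧' same (popped k)

empty full : ℕ → Formula
empty k = pushed k ≈X[ 0 ]ˡ popped k
full k  = pushed k ≈X[ 0 ]ˡ target

module _ {R : ℕ} where

  move : (Fin R → Action) → ℕ → Formula
  move f q = ⋀ (λ r → act (f r) (toℕ r)) ∧' X (state q)

  effect : ℕ → Command R → Formula
  effect q (incr r k)    = move (only r push) k
  effect q (decr r k k') = (empty (toℕ r) ⇒' move (const keep) k)
                        ∧' (¬' empty (toℕ r) ⇒' move (only r pop) k')
  -- A push is made in the full case too: loading starts at position 1, so at the position n marked
  -- by `numeral n` only n - 1 elements are in.
  effect q (load r k)    = (full (toℕ r) ⇒' move (only r push) k)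
                        ∧' (¬' full (toℕ r) ⇒' move (only r push) q)
  effect q (stop r)      = empty (toℕ r)
  effect q idle          = ⊤'

  rules : ℕ → List (Command R) → Formula
  rules q []       = ⊤'
  rules q (c ∷ cs) = (state q ⇒' effect q c) ∧' rules (suc q) cs

-- The remote copies make the sequences of pushed and of popped elements run
-- through the same values.
queue : LocalVar → LocalVar → Formula
queue h l = (h ≈ˡʳ h ∧' l ≈ˡʳ l)
         ∧' (above h ∨' same h) ∧' (above l ∨' same l)
         ∧' (h ≈X[ 0 ]ˡ l ∨' h ≈XFʳ l) ∧' (l ≈X[ 0 ]ˡ h ∨' l ≈XF⁻¹ʳ h)

always computation : ∀ {R} → List (Command R) → Formula
always {R} P = same target ∧' ⋀ (λ (r : Fin R) → queue (pushed (toℕ r)) (popped (toℕ r))) ∧' rules 0 P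
computation {R} P = (state 0 ∧' ⋀ (λ (r : Fin R) → empty (toℕ r))) ∧' □ (always P)

-- The number enters only as an exponent, so the code of the whole conjunction is a simple
-- arithmetical function of it and of the code of the other conjunct.
numeral : ℕ → Formula
numeral n = target ≈X[ n ]ˡ pushed 0

-- Reasoning with the derived connectives

module Connectives {a ℓ : Level} {D : Set a} {_<ᴰ_ : Rel D ℓ} where

  open Semantics D _<ᴰ_

  ∨-elim : ∀ {b c} {A : Set b} {B : Set c} → ¬ (¬ A × ¬ B) → ¬ ¬ (A ⊎ B)
  ∨-elim p k = p (k ∘ inj₁ , k ∘ inj₂)

  module _ (σ : Model) where

    ⊤-intro : ∀ {i} → σ , i ⊨ ⊤'
    ⊤-intro (t , ¬t) = ¬t t

    □-intro : ∀ φ {i} → (∀ j → σ , j ⊨ φ) → σ , i ⊨ □ φ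
    □-intro φ all (j , _ , ¬φ , _) = ¬φ (all j)

    □-elim : ∀ φ → σ , 0 ⊨ □ φ → ∀ j → ¬ ¬ (σ , j ⊨ φ)
    □-elim φ all j ¬φ = all (j , z≤n , ¬φ , λ _ _ _ → ⊤-intro)

    ⋀-intro : ∀ {n i} (f : Fin n → Formula) → (∀ x → σ , i ⊨ f x) → σ , i ⊨ ⋀ f
    ⋀-intro {zero}  f all = ⊤-intro
    ⋀-intro {suc n} f all = all zero , ⋀-intro (f ∘ suc) (all ∘ suc)

    ⋀-elim : ∀ {n i} (f : Fin n → Formula) → σ , i ⊨ ⋀ f → ∀ x → σ , i ⊨ f x
    ⋀-elim f (p , ps) zero    = p
    ⋀-elim f (p , ps) (suc x) = ⋀-elim (f ∘ suc) ps x

    module _ {R : ℕ} where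

      rules-intro : ∀ {i} q (cs : List (Command R)) →
        (∀ k → σ , i ⊨ state (k + q) → σ , i ⊨ effect (k + q) (fetch cs k)) → σ , i ⊨ rules q cs
      rules-intro q []       all = ⊤-intro
      rules-intro {i} q (c ∷ cs) all = (λ (s , ¬e) → ¬e (all 0 s)) , rules-intro (suc q) cs
        λ k → subst (λ p → σ , i ⊨ state p → σ , i ⊨ effect p (fetch cs k)) (sym (ℕ.+-suc k q)) (all (suc k))

      rules-elim : ∀ {i} q (cs : List (Command R)) → σ , i ⊨ rules q cs →
        ∀ k → σ , i ⊨ state (k + q) → ¬ ¬ (σ , i ⊨ effect (k + q) (fetch cs k))
      rules-elim q []       p        k       s ¬e = ¬e (⊤-intro)
      rules-elim q (c ∷ cs) (p , ps) zero    s ¬e = p (s , ¬e)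
      rules-elim {i} q (c ∷ cs) (p , ps) (suc k) =
        subst (λ p → σ , i ⊨ state p → ¬ ¬ (σ , i ⊨ effect p (fetch cs k))) (ℕ.+-suc k q)
          (rules-elim (suc q) cs ps k)

    now : ∀ i x → σ (i + 0) x ≡ σ i x
    now i x = cong (λ j → σ j x) (ℕ.+-identityʳ i)

    soon : ∀ i x → σ (i + 1) x ≡ σ (suc i) x
    soon i x = cong (λ j → σ j x) (ℕ.+-comm i 1)

-- From models to runs

module Soundness {a ℓ : Level} {D : Set a} {_<ᴰ_ : Rel D ℓ} (sto : IsStrictTotalOrder _≡_ _<ᴰ_)
  {R : ℕ} (P : List (Command R)) where

  open Semantics D _<ᴰ_
  open Connectives {D = D} {_<ᴰ_}
  private module O = IsStrictTotalOrder sto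

  infix 4 _≤ᴰ_
  -- As a negation, this order can be derived from doubly negated facts about a model.
  _≤ᴰ_ : Rel D ℓ
  x ≤ᴰ y = ¬ (y <ᴰ x)

  ≤ᴰ-refl : ∀ {x} → x ≤ᴰ x
  ≤ᴰ-refl = O.irrefl refl

  ≤ᴰ-trans : ∀ {x y z} → x ≤ᴰ y → y ≤ᴰ z → x ≤ᴰ z
  ≤ᴰ-trans {x} {y} x≤y y≤z z<x with O.compare x y
  ... | tri< x<y _ _  = y≤z (O.trans z<x x<y)
  ... | tri≈ _ refl _ = y≤z z<x
  ... | tri> _ _ y<x  = x≤y y<x

  ≤ᴰ-antisym : ∀ {x y} → x ≤ᴰ y → y ≤ᴰ x → x ≡ y
  ≤ᴰ-antisym {x} {y} x≤y y≤x with O.compare x y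
  ... | tri< x<y _ _ = contradiction x<y y≤x
  ... | tri≈ _ x≡y _ = x≡y
  ... | tri> _ _ y<x = contradiction y<x x≤y

  <-≤ᴰ-trans : ∀ {x y z} → x <ᴰ y → y ≤ᴰ z → x <ᴰ z
  <-≤ᴰ-trans {x} {y} {z} x<y y≤z with O.compare x z
  ... | tri< x<z _ _  = x<z
  ... | tri≈ _ refl _ = contradiction x<y y≤z
  ... | tri> _ _ z<x  = contradiction (O.trans z<x x<y) y≤z

  monotone : (f : ℕ → D) → (∀ i → f i ≤ᴰ f (suc i)) → ∀ {i j} → i ≤ j → f i ≤ᴰ f j
  monotone f step i≤j = go (ℕ.≤⇒≤′ i≤j)
    where
    go : ∀ {i j} → i ≤′ j → f i ≤ᴰ f j
    go ≤′-refl       = ≤ᴰ-refl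
    go (≤′-step i≤j) = ≤ᴰ-trans (go i≤j) (step _)

  -- Trichotomy decides equality, so equations between data values escape the double negations.
  stable-≡ : ∀ {x y : D} → ¬ ¬ (x ≡ y) → x ≡ y
  stable-≡ = decidable-stable (_ O.≟ _)

  module InModel (σ : Model) (sat : σ , 0 ⊨ computation P) where

    h l : Fin R → ℕ → D
    h r i = σ i (inj₁ (pushed (toℕ r)))
    l r i = σ i (inj₁ (popped (toℕ r)))

    private
      globally : ∀ i → ¬ ¬ (σ , i ⊨ always P)
      globally = □-elim σ (always P) (proj₂ sat)

      ≈-now : ∀ {i x y} → σ , i ⊨ x ≈X[ 0 ]ˡ y → σ i (inj₁ x) ≡ σ i (inj₁ y)
      ≈-now {i} p = trans (lower p) (now σ i _)

      ≈-now⁻ : ∀ {i x y} → σ i (inj₁ x) ≡ σ i (inj₁ y) → σ , i ⊨ x ≈X[ 0 ]ˡ y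
      ≈-now⁻ {i} p = lift (trans p (sym (now σ i _)))

      stays : ∀ {i x} → σ , i ⊨ same x → σ (suc i) (inj₁ x) ≡ σ i (inj₁ x)
      stays {i} p = sym (trans (lower p) (soon σ i _))

      rises : ∀ {i x} → σ , i ⊨ above x → σ i (inj₁ x) <ᴰ σ (suc i) (inj₁ x)
      rises {i} {x} p = subst (σ i (inj₁ x) <ᴰ_) (soon σ i _) (lower p)

      step-≤ : ∀ {i x} → (σ , i ⊨ above x) ⊎ (σ , i ⊨ same x) → σ i (inj₁ x) ≤ᴰ σ (suc i) (inj₁ x)
      step-≤     (inj₁ p) = O.asym (rises p)
      step-≤ {i} {x} (inj₂ p) = subst (σ i (inj₁ x) ≤ᴰ_) (sym (stays p)) ≤ᴰ-refl

      queues : ∀ (r : Fin R) i → ¬ ¬ (σ , i ⊨ queue (pushed (toℕ r)) (popped (toℕ r)))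
      queues r i k = globally i λ (_ , q , _) → k (⋀-elim σ (λ r → queue (pushed (toℕ r)) (popped (toℕ r))) q r)

      h-mirror : ∀ (r : Fin R) i → h r i ≡ σ i (inj₂ (pushed (toℕ r)))
      h-mirror r i = stable-≡ λ k → queues r i λ ((p , _) , _) → k (lower p)

      l-mirror : ∀ (r : Fin R) i → l r i ≡ σ i (inj₂ (popped (toℕ r)))
      l-mirror r i = stable-≡ λ k → queues r i λ ((_ , p) , _) → k (lower p)

    target-constant : ∀ i → σ i (inj₁ target) ≡ σ 0 (inj₁ target)
    target-constant zero    = refl
    target-constant (suc i) =
      trans (stable-≡ λ k → globally i λ (p , _) → k (stays p)) (target-constant i)

    h-mono : ∀ r {i j} → i ≤ j → h r i ≤ᴰ h r j
    h-mono r = monotone (h r) λ i down → queues r i λ (_ , p , _) →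
      ∨-elim p λ q → step-≤ q down

    l-mono : ∀ r {i j} → i ≤ j → l r i ≤ᴰ l r j
    l-mono r = monotone (l r) λ i down → queues r i λ (_ , _ , p , _) →
      ∨-elim p λ q → step-≤ q down

    -- The future witness concerns remote variables; the mirror equations carry it back to the local
    -- ones, where the order is available.
    h⊆l : ∀ (r : Fin R) i → ¬ ¬ (∃ λ j → h r i ≡ l r j)
    h⊆l r i k = queues r i λ (_ , _ , _ , p , _) → ∨-elim p λ where
      (inj₁ p)                  → k (i , ≈-now p)
      (inj₂ (lift (j , _ , p))) → k (j , trans (h-mirror r i) (trans p (sym (l-mirror r j))))

    l⊆h : ∀ (r : Fin R) i → ¬ ¬ (∃ λ j → l r i ≡ h r j)
    l⊆h r i k = queues r i λ (_ , _ , _ , _ , p) → ∨-elim p λ where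
      (inj₁ p)                  → k (i , ≈-now p)
      (inj₂ (lift (j , _ , p))) → k (j , trans (l-mirror r i) (trans p (sym (h-mirror r j))))

    rule : ∀ q i → σ , i ⊨ state q → ¬ ¬ (σ , i ⊨ effect q (fetch P q))
    rule q i s k = globally i λ (_ , _ , p) →
      subst (λ q' → σ , i ⊨ state q' → ¬ ¬ (σ , i ⊨ effect q' (fetch P q))) (ℕ.+-identityʳ q)
        (rules-elim σ 0 P p q) s k

    -- The immediate successor in the set of values ever pushed. Since popped values range over the
    -- same set, one notion measures the moves of both variables.
    record Next (r : Fin R) (x y : D) : Set (a Level.⊔ ℓ) where
      constructor next
      field
        less  : x <ᴰ y
        occur : ¬ ¬ (∃ λ j → y ≡ h r j)
        least : ∀ j → x <ᴰ h r j → y ≤ᴰ h r j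

    Next-unique : ∀ {r x y y'} → Next r x y → Next r x y' → y ≡ y'
    Next-unique p q = ≤ᴰ-antisym (half p q) (half q p)
      where
      half : ∀ {r x y y'} → Next r x y → Next r x y' → y ≤ᴰ y'
      half (next _ _ least) (next x<y' occur _) y'<y =
        occur λ where (j , refl) → least j x<y' y'<y

    -- By monotonicity, what is pushed up to i lies at or below `h r i`, and what is pushed
    -- afterwards at or above `h r (suc i)`; nothing falls between.
    push-Next : ∀ r i → h r i <ᴰ h r (suc i) → Next r (h r i) (h r (suc i))
    push-Next r i up = next up (λ k → k (suc i , refl)) λ j hᵢ<hⱼ → case ℕ.≤-<-connex j i of λ where
      (inj₁ j≤i) → contradiction hᵢ<hⱼ (h-mono r j≤i)
      (inj₂ i<j) → h-mono r i<j

    -- An element pushed between l r i and l r (suc i) could never be popped.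
    pop-Next : ∀ r i → l r i <ᴰ l r (suc i) → Next r (l r i) (l r (suc i))
    pop-Next r i up = next up (l⊆h r (suc i)) λ j lᵢ<hⱼ hⱼ<lᵢ₊₁ → h⊆l r j λ (k , eq) →
      case ℕ.≤-<-connex k i of λ where
        (inj₁ k≤i) → l-mono r k≤i (subst (l r i <ᴰ_) eq lᵢ<hⱼ)
        (inj₂ i<k) → l-mono r i<k (subst (_<ᴰ l r (suc i)) eq hⱼ<lᵢ₊₁)

    -- The path from the last popped to the last pushed value has the counter's value as its length.
    -- A push appends a step at the far end; a pop removes the first step, which uniqueness of
    -- successors identifies with the move of the popped variable.
    data Distance (r : Fin R) : D → D → ℕ → Set (a Level.⊔ ℓ) where
      []  : ∀ {x} → Distance r x x 0
      _∷_ : ∀ {x y z n} → Next r x y → Distance r y z n → Distance r x z (suc n)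

    _∷ʳ_ : ∀ {r x y z n} → Distance r x y n → Next r y z → Distance r x z (suc n)
    []      ∷ʳ q = q ∷ []
    (p ∷ d) ∷ʳ q = p ∷ (d ∷ʳ q)

    Distance-≤ : ∀ {r x y n} → Distance r x y n → x ≤ᴰ y
    Distance-≤ []      = ≤ᴰ-refl
    Distance-≤ (p ∷ d) = ≤ᴰ-trans (O.asym (Next.less p)) (Distance-≤ d)

    Distance-0 : ∀ {r x y n} → n ≡ 0 → Distance r x y n → x ≡ y
    Distance-0 refl [] = refl

    -- The first step is strict and the rest never descends. Together with `Distance-0` this makes
    -- the zero test by equality exact.
    Distance-suc : ∀ {r x y n m} → n ≡ suc m → Distance r x y n → x <ᴰ y
    Distance-suc refl (p ∷ d) = <-≤ᴰ-trans (Next.less p) (Distance-≤ d)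

    Distance-tail : ∀ {r x x' y n} → Next r x x' → Distance r x y (suc n) → Distance r x' y n
    Distance-tail p (q ∷ d) with refl ← Next-unique p q = d

    Holds : ℕ → Fin R → ℕ → Set (a Level.⊔ ℓ)
    Holds i r = Distance r (l r i) (h r i)

    holds-keep : ∀ {i r n} → σ , i ⊨ act keep (toℕ r) → Holds i r n → Holds (suc i) r n
    holds-keep {r = r} (p , q) d = subst₂ (λ x y → Distance r x y _) (sym (stays q)) (sym (stays p)) d

    holds-push : ∀ {i r n} → σ , i ⊨ act push (toℕ r) → Holds i r n → Holds (suc i) r (suc n)
    holds-push {i} {r} (p , q) d =
      subst (λ x → Distance r x (h r (suc i)) _) (sym (stays q)) (d ∷ʳ push-Next r i (rises p))

    holds-pop : ∀ {i r n} → σ , i ⊨ act pop (toℕ r) → Holds i r (suc n) → Holds (suc i) r n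
    holds-pop {i} {r} (p , q) d =
      subst (λ y → Distance r (l r (suc i)) y _) (sym (stays p)) (Distance-tail (pop-Next r i (rises q)) d)

    -- Other states may hold at the same position; it is enough to follow the one of the run.
    Config-at : ℕ → ℕ → Vec ℕ R → Set (a Level.⊔ ℓ)
    Config-at i q v = σ , i ⊨ state q × (∀ r → Holds i r (lookup v r))

    move-keep : ∀ i k v → (∀ r → Holds i r (lookup v r)) → σ , i ⊨ move {R} (const keep) k →
                Config-at (suc i) k v
    move-keep i k v d (m , s) = s , λ x → holds-keep (⋀-elim σ _ m x) (d x)

    private
      act-only : ∀ {i} (r : Fin R) a → σ , i ⊨ ⋀ (λ x → act (only r a x) (toℕ x)) →
                 (σ , i ⊨ act a (toℕ r)) × (∀ {x} → x ≢ r → σ , i ⊨ act keep (toℕ x))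
      act-only {i} r a m =
        subst (λ b → σ , i ⊨ act b (toℕ r)) (only-≡ r a) (⋀-elim σ _ m r) ,
        λ {x} x≢r → subst (λ b → σ , i ⊨ act b (toℕ x)) (only-≢ a x≢r) (⋀-elim σ _ m x)

    move-push : ∀ i k v r → (∀ r → Holds i r (lookup v r)) → σ , i ⊨ move {R} (only r push) k →
                Config-at (suc i) k (v [ r ]%= suc)
    move-push i k v r d (m , s) = s , holds
      where
      holds : ∀ x → Holds (suc i) x (lookup (v [ r ]%= suc) x)
      holds x with x Fin.≟ r
      ... | yes refl rewrite lookup∘updateAt x {suc} v = holds-push (proj₁ (act-only x push m)) (d x)
      ... | no x≢r   rewrite lookup∘updateAt′ x r {suc} x≢r v = holds-keep (proj₂ (act-only r push m) x≢r) (d x)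

    move-pop : ∀ i k v {r n} → (∀ r → Holds i r (lookup v r)) → lookup v r ≡ suc n →
               σ , i ⊨ move {R} (only r pop) k → Config-at (suc i) k (v [ r ]≔ n)
    move-pop i k v {r} {n} d eq (m , s) = s , holds
      where
      holds : ∀ x → Holds (suc i) x (lookup (v [ r ]≔ n) x)
      holds x with x Fin.≟ r
      ... | yes refl rewrite lookup∘updateAt x {const n} v =
        holds-pop (proj₁ (act-only x pop m)) (subst (Holds i x) eq (d x))
      ... | no x≢r   rewrite lookup∘updateAt′ x r {const n} x≢r v =
        holds-keep (proj₂ (act-only r pop m) x≢r) (d x)

    -- The rules force the model along the run up to `stop`, where `effect` demands an empty
    -- register although its distance is positive. As the goal is absurdity, doubly negated rules
    -- apply directly.
    refute : ∀ {m i q v} → Run P (suc m) q v → ¬ Config-at i q v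
    refute {i = i} {q} (stop f out) (s , d) = rule q i s λ e →
      let e' = subst (λ c → σ , i ⊨ effect q c) f e
      in O.irrefl (sym (≈-now e')) (Distance-suc out (d _))
    refute {i = i} {q} {v} (incr {k = k} f run) (s , d) = rule q i s λ e →
      refute run (move-push i k v _ d (subst (λ c → σ , i ⊨ effect q c) f e))
    refute {i = i} {q} {v} (decr₀ {k = k} f z run) (s , d) = rule q i s λ e →
      proj₁ (subst (λ c → σ , i ⊨ effect q c) f e)
        (≈-now⁻ (sym (Distance-0 z (d _))) , λ m → refute run (move-keep i k v d m))
    refute {i = i} {q} {v} (decr₊ {k' = k} f p run) (s , d) = rule q i s λ e →
      proj₂ (subst (λ c → σ , i ⊨ effect q c) f e)
        ((λ z → O.irrefl (sym (≈-now z)) (Distance-suc p (d _))) , λ m → refute run (move-pop i k v d p m))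

    initial : Config-at 0 0 (replicate R 0)
    initial = proj₁ (proj₁ sat) , λ r →
      subst (Holds 0 r) (sym (lookup-replicate r 0))
        (subst (λ y → Distance r (l r 0) y 0)
          (sym (≈-now (⋀-elim σ (λ r → empty (toℕ r)) (proj₂ (proj₁ sat)) r))) [])

-- The loading phase of a model

loaded : ∀ {r} → ℕ → Vec ℕ (6 + r)
-- The entry 1 is the junk register, incremented at address 0.
loaded {r} n = n ∷ 0 ∷ 0 ∷ 0 ∷ 1 ∷ replicate (suc r) 0

module LoadingSound {a ℓ : Level} {D : Set a} {_<ᴰ_ : Rel D ℓ} (sto : IsStrictTotalOrder _≡_ _<ᴰ_)
  {r : ℕ} {P : List (Command (6 + r))} (at₀ : fetch P 0 ≡ incr #j 1) (at₁ : fetch P 1 ≡ load #n 2) where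

  open Semantics D _<ᴰ_
  open Connectives {D = D} {_<ᴰ_}
  open Soundness sto P
  private module O = IsStrictTotalOrder sto

  module _ {σ : Model} {n : ℕ} (sat : σ , 0 ⊨ computation P ∧' numeral (suc n)) where

    open InModel σ (proj₁ sat)

    private
      hit : ∀ i → σ i (inj₁ target) ≡ h zero (suc n)
      hit i = trans (target-constant i) (lower (proj₂ sat))

      loading : ∀ i → i ≤ n → ¬ ¬ Config-at (suc i) 1 (loaded i)
      loading zero _ k = rule 0 0 (proj₁ (initial)) λ e →
        k (move-push 0 1 (replicate (6 + r) 0) #j (proj₂ (initial))
             (subst (λ c → σ , 0 ⊨ effect 0 c) at₀ e))
      loading (suc i) i<n k = loading i (ℕ.<⇒≤ i<n) λ c →
        rule 1 (suc i) (proj₁ c) λ e →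
        let e' = subst (λ c → σ , suc i ⊨ effect 1 c) at₁ e in
        proj₂ e'
          -- A push after reaching the target too early would move beyond it.
          ( (λ full → proj₁ e' (full , λ m →
              h-mono zero (s≤s i<n)
                (subst₂ _<ᴰ_ (trans (trans (lower full) (now σ (suc i) _)) (hit (suc i))) (soon σ (suc i) _)
                  (lower (proj₁ (proj₁ (proj₁ m)))))))
          , λ m → k (move-push (suc i) 1 (loaded i) #n (proj₂ c) m))

    load-complete : ¬ ¬ Config-at (2 + n) 2 (loaded (suc n))
    load-complete k = loading n ℕ.≤-refl λ c →
      rule 1 (suc n) (proj₁ c) λ e →
      proj₁ (subst (λ c → σ , suc n ⊨ effect 1 c) at₁ e)
        ( lift (trans (sym (hit (suc n))) (sym (now σ (suc n) _)))
        , λ m → k (move-push (suc n) 2 (loaded n) #n (proj₂ c) m))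

    no-positive-output : ∀ {o} → ¬ Run P (suc o) 2 (loaded (suc n))
    no-positive-output run = load-complete (refute run)

-- From runs to models

module Chains {a ℓ : Level} {D : Set a} {_<ᴰ_ : Rel D ℓ} (sto : IsStrictTotalOrder _≡_ _<ᴰ_) where

  private module O = IsStrictTotalOrder sto

  insert : D → List D → List D
  insert x []       = x ∷ []
  insert x (y ∷ ys) with O.compare x y
  ... | tri< _ _ _ = x ∷ y ∷ ys
  ... | tri≈ _ _ _ = y ∷ ys
  ... | tri> _ _ _ = y ∷ insert x ys

  insert-All : ∀ {p} {Q : D → Set p} {x} ys → Q x → All Q ys → All Q (insert x ys)
  insert-All []       q []       = q ∷ []
  insert-All {x = x} (y ∷ ys) q (r ∷ rs) with O.compare x y
  ... | tri< _ _ _ = q ∷ r ∷ rs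
  ... | tri≈ _ _ _ = r ∷ rs
  ... | tri> _ _ _ = r ∷ insert-All ys q rs

  private
    weaken : ∀ {x y ys} → x <ᴰ y → All (y <ᴰ_) ys → All (x <ᴰ_) ys
    weaken x<y []       = []
    weaken x<y (p ∷ ps) = O.trans x<y p ∷ weaken x<y ps

  insert-sorted : ∀ x ys → AllPairs _<ᴰ_ ys → AllPairs _<ᴰ_ (insert x ys)
  insert-sorted x []       []       = [] ∷ []
  insert-sorted x (y ∷ ys) (p ∷ ps) with O.compare x y
  ... | tri< x<y _ _ = (x<y ∷ weaken x<y p) ∷ p ∷ ps
  ... | tri≈ _ _ _   = p ∷ ps
  ... | tri> _ _ y<x = insert-All ys y<x p ∷ insert-sorted x ys ps

  length-insert : ∀ x ys → x ∉ ys → length (insert x ys) ≡ suc (length ys)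
  length-insert x []       x∉ = refl
  length-insert x (y ∷ ys) x∉ with O.compare x y
  ... | tri< _ _ _   = refl
  ... | tri≈ _ x≡y _ = contradiction (here x≡y) x∉
  ... | tri> _ _ _   = cong suc (length-insert x ys (x∉ ∘ there))

  -- `Infinite` only refutes exhaustive lists. If no longer sorted list existed, no element could be
  -- outside `xs`, and decidable membership would make `xs` exhaustive.
  sorted-list : Infinite D → ∀ n → ¬ ¬ (∃ λ xs → AllPairs _<ᴰ_ xs × length xs ≡ n)
  sorted-list inf zero    k = k ([] , [] , refl)
  sorted-list inf (suc n) k = sorted-list inf n λ (xs , sorted , len) →
    inf (xs , λ x → decidable-stable (any? (x O.≟_) xs) λ x∉xs →
      k (insert x xs , insert-sorted x xs sorted , trans (length-insert x xs x∉xs) (cong suc len)))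

  nth : D → List D → ℕ → D
  nth e []       i       = e
  nth e (x ∷ xs) zero    = x
  nth e (x ∷ xs) (suc i) = nth e xs i

  nth-All : ∀ {p} {Q : D → Set p} {e} xs → All Q xs → ∀ {i} → i < length xs → Q (nth e xs i)
  nth-All (x ∷ xs) (q ∷ qs) {zero}  i<         = q
  nth-All (x ∷ xs) (q ∷ qs) {suc i} (s≤s i<) = nth-All xs qs i<

  nth-mono : ∀ {e} xs → AllPairs _<ᴰ_ xs → ∀ {i j} → i < j → j < length xs → nth e xs i <ᴰ nth e xs j
  nth-mono (x ∷ xs) (p ∷ ps) {zero}  {suc j} i<j       (s≤s j<) = nth-All xs p j<
  nth-mono (x ∷ xs) (p ∷ ps) {suc i} {suc j} (s≤s i<j) (s≤s j<) = nth-mono xs ps i<j j<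

  -- The order of D may lack infinite increasing sequences, hence the bound.
  chain : Infinite D → ∀ b → ¬ ¬ (∃ λ (d : ℕ → D) → ∀ {i j} → i < j → j ≤ b → d i <ᴰ d j)
  chain inf b k = sorted-list inf (suc b) λ where
    (x ∷ xs , sorted , refl) → k (nth x (x ∷ xs) , λ i<j j≤b → nth-mono (x ∷ xs) sorted i<j (s≤s j≤b))

-- Traces of pushes and pops

abstract
  -- Data.Nat.Properties._≟_ unfolds to _≡ᵇ_, which with-abstraction misses.
  _≟ℕ_ : (i j : ℕ) → Dec (i ≡ j)
  _≟ℕ_ = ℕ._≟_

-- A discrete intermediate value theorem: rising by at most one per step, `f` cannot jump over y.
intermediate : (f : ℕ → ℕ) → (∀ i → f (suc i) ≤ suc (f i)) →
  ∀ k i {y} → f i ≤ y → y ≤ f (k + i) → ∃ λ j → i ≤ j × j ≤ k + i × f j ≡ y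
intermediate f slow zero    i fi≤y y≤fi = i , ℕ.≤-refl , ℕ.≤-refl , ℕ.≤-antisym fi≤y y≤fi
intermediate f slow (suc k) i {y} fi≤y y≤ with f i ≟ℕ y
... | yes fi≡y = i , ℕ.≤-refl , ℕ.m≤n+m i (suc k) , fi≡y
... | no  fi≢y with intermediate f slow k (suc i) (ℕ.≤-trans (slow i) (ℕ.≤∧≢⇒< fi≤y fi≢y))
                      (subst (λ m → y ≤ f m) (sym (ℕ.+-suc k i)) y≤)
...   | j , i<j , j≤ , eq = j , ℕ.<⇒≤ i<j , subst (j ≤_) (ℕ.+-suc k i) j≤ , eq

pushes pops : Action → ℕ → ℕ
pushes push = suc
pushes _    = λ m → m
pops pop = suc
pops _   = λ m → m

-- A configuration counts the pushes and pops of every queue so far; the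
-- load stops once n elements have been pushed.
module Trace {R : ℕ} (P : List (Command R)) (n : ℕ) where

  record Conf : Set where
    constructor conf
    field
      at       : ℕ
      ins outs : Fin R → ℕ

  open Conf public

  -- `queue` demands that every pushed element be popped eventually, also those left over when the
  -- run stops; popping all nonempty queues after the run fulfils this.
  drain : Conf → Fin R → Action
  drain c x = if does (ins c x ≟ℕ outs c x) then keep else pop

  plan : Command R → Conf → (Fin R → Action) × ℕ
  plan (incr r k)    c = only r push , k
  plan (decr r k k') c = if does (ins c r ≟ℕ outs c r) then (const keep , k) else (only r pop , k')
  -- The push made at count n is the last one, so `suc n` elements get loaded.
  plan (load r k)    c = only r push , (if does (ins c r ≟ℕ n) then k else at c)
  -- The first address past the program fetches `idle`, so the trace drains from there on.
  plan (stop r)      c = const keep , length P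
  plan idle          c = drain c , at c

  apply : (Fin R → Action) × ℕ → Conf → Conf
  apply (f , k) c = conf k (λ x → pushes (f x) (ins c x)) (λ x → pops (f x) (outs c x))

  current : Conf → (Fin R → Action) × ℕ
  current c = plan (fetch P (at c)) c

  advance : Conf → Conf
  advance c = apply (current c) c

  trace : Conf → ℕ → Conf
  trace c zero    = c
  trace c (suc i) = advance (trace c i)

  trace-advance : ∀ c i → trace (advance c) i ≡ trace c (suc i)
  trace-advance c zero    = refl
  trace-advance c (suc i) = cong advance (trace-advance c i)

  module _ (c : Conf) (r : Fin R) (k k' : ℕ) where

    plan-decr₀ : ins c r ≡ outs c r → plan (decr r k k') c ≡ (const keep , k)
    plan-decr₀ eq with ins c r ≟ℕ outs c r
    ... | yes _ = refl
    ... | no ne = contradiction eq ne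

    plan-decr₊ : ins c r ≢ outs c r → plan (decr r k k') c ≡ (only r pop , k')
    plan-decr₊ ne with ins c r ≟ℕ outs c r
    ... | yes eq = contradiction eq ne
    ... | no _   = refl

  module _ (c : Conf) (r : Fin R) (k : ℕ) where

    plan-load₌ : ins c r ≡ n → plan (load r k) c ≡ (only r push , k)
    plan-load₌ eq with ins c r ≟ℕ n
    ... | yes _ = refl
    ... | no ne = contradiction eq ne

    plan-load₁ : ins c r ≢ n → plan (load r k) c ≡ (only r push , at c)
    plan-load₁ ne with ins c r ≟ℕ n
    ... | yes eq = contradiction eq ne
    ... | no _   = refl

  -- A pop is planned only where the two counts differ, that is, where the inequality is strict.
  outs≤ins-advance : ∀ c x → outs c x ≤ ins c x → outs (advance c) x ≤ ins (advance c) x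
  outs≤ins-advance c x le = go (fetch P (at c))
    where
    keeps : ∀ {f : Fin R → Action} → pops (f x) (outs c x) ≡ outs c x →
            pops (f x) (outs c x) ≤ pushes (f x) (ins c x)
    keeps {f} eq rewrite eq with f x
    ... | push = ℕ.m≤n⇒m≤1+n le
    ... | pop  = le
    ... | keep = le
    pushing : ∀ r → pops (only r push x) (outs c x) ≡ outs c x
    pushing r with x Fin.≟ r
    ... | yes _ = refl
    ... | no _  = refl
    go : ∀ cmd → let f = proj₁ (plan cmd c) in pops (f x) (outs c x) ≤ pushes (f x) (ins c x)
    go (incr r k) = keeps {only r push} (pushing r)
    go (decr r k k') with ins c r ≟ℕ outs c r
    ... | yes _ = le
    ... | no ne with x Fin.≟ r
    ...   | yes refl = ℕ.≤∧≢⇒< le (ne ∘ sym)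
    ...   | no _     = le
    go (load r k) = keeps {only r push} (pushing r)
    go (stop r)   = le
    go idle with ins c x ≟ℕ outs c x
    ... | yes _ = le
    ... | no ne = ℕ.≤∧≢⇒< le (ne ∘ sym)

  ins-mono : ∀ c x → ins c x ≤ ins (advance c) x
  ins-mono c x with proj₁ (current c) x
  ... | push = ℕ.n≤1+n _
  ... | pop  = ℕ.≤-refl
  ... | keep = ℕ.≤-refl

  ins-slow : ∀ c x → ins (advance c) x ≤ suc (ins c x)
  ins-slow c x with proj₁ (current c) x
  ... | push = ℕ.≤-refl
  ... | pop  = ℕ.n≤1+n _
  ... | keep = ℕ.n≤1+n _

  outs-slow : ∀ c x → outs (advance c) x ≤ suc (outs c x)
  outs-slow c x with proj₁ (current c) x
  ... | push = ℕ.n≤1+n _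
  ... | pop  = ℕ.≤-refl
  ... | keep = ℕ.n≤1+n _

  Dead : Conf → Set
  Dead c = at c ≡ length P

  dead-fetch : ∀ c → Dead c → fetch P (at c) ≡ idle
  dead-fetch c dead = trans (cong (fetch P) dead) (fetch-end P)

  dead-advance : ∀ {c} → Dead c → advance c ≡ apply (drain c , at c) c
  dead-advance {c} dead = cong (λ cmd → apply (plan cmd c) c) (dead-fetch c dead)

  advance-dead : ∀ {c} → Dead c → Dead (advance c)
  advance-dead dead = trans (cong at (dead-advance dead)) dead

  dead-ins : ∀ {c} x → Dead c → ins (advance c) x ≡ ins c x
  dead-ins {c} x dead rewrite dead-fetch c dead with ins c x ≟ℕ outs c x
  ... | yes _ = refl
  ... | no _  = refl

  -- In a dead trace pushes are frozen, and each step pops one element as long as some remain, so a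
  -- backlog of at most k is gone after k steps.
  dead-drains : ∀ k {c} x → Dead c → ins c x ≤ k + outs c x → ins c x ≤ outs (trace c k) x
  dead-drains zero    x dead le = le
  dead-drains (suc k) {c} x dead le = subst (λ c' → ins c x ≤ outs c' x) (trace-advance c k)
    (subst (_≤ outs (trace (advance c) k) x) (dead-ins x dead)
      (dead-drains k x (advance-dead dead)
        (subst (_≤ k + outs (advance c) x) (sym (dead-ins x dead)) drained)))
    where
    drained : ins c x ≤ k + outs (advance c) x
    drained rewrite dead-fetch c dead with ins c x ≟ℕ outs c x
    ... | yes eq = ℕ.≤-trans (ℕ.≤-reflexive eq) (ℕ.m≤n+m _ k)
    ... | no _   = ℕ.≤-trans le (ℕ.≤-reflexive (sym (ℕ.+-suc k (outs c x))))

  -- `running` excludes `stop` before the end, so the demand that `effect` makes of a `stop` arises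
  -- only once, at the final test in `halted`.
  data Halts : Conf → Set where
    halted  : ∀ {c r} → fetch P (at c) ≡ stop r → ins c r ≡ outs c r → Halts c
    running : ∀ {c} → (∀ r → fetch P (at c) ≢ stop r) → Halts (advance c) → Halts c

  trace-dead : ∀ {c} → Dead c → ∀ i → Dead (trace c i)
  trace-dead dead zero    = dead
  trace-dead dead (suc i) = advance-dead (trace-dead dead i)

  halts-dead : ∀ {c} → Halts c → ∃ λ t → Dead (trace c t)
  halts-dead {c} (halted f _) = 1 , cong (λ cmd → proj₂ (plan cmd c)) f
  halts-dead {c} (running _ h) with halts-dead h
  ... | t , dead = suc t , subst Dead (trace-advance c t) dead

  halts-output : ∀ {c} → Halts c → ∀ i {r} → fetch P (at (trace c i)) ≡ stop r →
                 ins (trace c i) r ≡ outs (trace c i) r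
  halts-output (halted f eq) zero    g with refl ← trans (sym f) g = eq
  -- After the `stop` the trace is dead and fetches `idle` forever.
  halts-output {c} (halted f eq) (suc i) {r} g =
    contradiction (trans (sym g) (dead-fetch (trace c (suc i))
      (subst Dead (trace-advance c i) (trace-dead (cong (λ cmd → proj₂ (plan cmd c)) f) i)))) λ ()
  halts-output (running ne h)   zero    g = contradiction g (ne _)
  halts-output {c} (running ne h) (suc i) {r} g with trace-advance c i
  ... | eq = subst (λ c' → ins c' r ≡ outs c' r) eq
               (halts-output h i (subst (λ c' → fetch P (at c') ≡ stop r) (sym eq) g))

  Represents : Conf → ℕ → Vec ℕ R → Set
  Represents c q v = at c ≡ q × (∀ x → ins c x ≡ lookup v x + outs c x)

  apply-keep : ∀ c v {q k} → Represents c q v → Represents (apply (const keep , k) c) k v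
  apply-keep c v (_ , eq) = refl , eq

  apply-push : ∀ c v r {q k} → Represents c q v → Represents (apply (only r push , k) c) k (v [ r ]%= suc)
  apply-push c v r (_ , eq) = refl , represents
    where
    represents : ∀ x → pushes (only r push x) (ins c x) ≡
                       lookup (v [ r ]%= suc) x + pops (only r push x) (outs c x)
    represents x with x Fin.≟ r
    ... | yes refl rewrite lookup∘updateAt x {suc} v = cong suc (eq x)
    ... | no x≢r   rewrite lookup∘updateAt′ x r {suc} x≢r v = eq x

  apply-pop : ∀ c v r {q k m} → lookup v r ≡ suc m → Represents c q v →
              Represents (apply (only r pop , k) c) k (v [ r ]≔ m)
  apply-pop c v r {m = m} pos (_ , eq) = refl , represents
    where
    represents : ∀ x → pushes (only r pop x) (ins c x) ≡
                       lookup (v [ r ]≔ m) x + pops (only r pop x) (outs c x)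
    represents x with x Fin.≟ r
    ... | yes refl rewrite lookup∘updateAt x {const m} v =
      trans (eq x) (trans (cong (_+ outs c x) pos) (sym (ℕ.+-suc m (outs c x))))
    ... | no x≢r   rewrite lookup∘updateAt′ x r {const m} x≢r v = eq x

  current-≡ : ∀ c {cmd p} → fetch P (at c) ≡ cmd → plan cmd c ≡ p → advance c ≡ apply p c
  current-≡ c f eq = cong (λ p → apply p c) (trans (cong (λ cmd → plan cmd c) f) eq)

  not-stop : ∀ {q cmd r} → fetch P q ≡ cmd → cmd ≢ stop r → fetch P q ≢ stop r
  not-stop f ne g = ne (trans (sym f) g)

  run-halts : ∀ {q v c} → Run P 0 q v → Represents c q v → Halts c
  run-halts {v = v} {c} (stop {r = r} f out) (refl , eq) =
    halted f (trans (eq r) (cong (_+ outs c r) out))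
  run-halts {v = v} {c} (incr {r = r} f run) rep@(refl , _) =
    running (λ _ → not-stop f λ ()) (subst Halts (sym (current-≡ c f refl)) (run-halts run (apply-push c v r rep)))
  run-halts {v = v} {c} (decr₀ {r = r} {k} {k'} f z run) rep@(refl , eq) =
    running (λ _ → not-stop f λ ()) (subst Halts (sym (current-≡ c f
      (plan-decr₀ c r k k' (trans (eq r) (cong (_+ outs c r) z))))) (run-halts run (apply-keep c v rep)))
  run-halts {v = v} {c} (decr₊ {r = r} {k} {k'} f p run) rep@(refl , eq) =
    running (λ _ → not-stop f λ ()) (subst Halts (sym (current-≡ c f
      (plan-decr₊ c r k k' λ z → ℕ.m≢1+n+m (outs c r) (trans (sym z) (trans (eq r) (cong (_+ outs c r) p))))))
      (run-halts run (apply-pop c v r p rep)))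

  start : Conf
  start = conf 0 (const 0) (const 0)

  outs≤ins : ∀ i x → outs (trace start i) x ≤ ins (trace start i) x
  outs≤ins zero    x = z≤n
  outs≤ins (suc i) x = outs≤ins-advance (trace start i) x (outs≤ins i x)

  ins≤time : ∀ i x → ins (trace start i) x ≤ i
  ins≤time zero    x = z≤n
  ins≤time (suc i) x = ℕ.≤-trans (ins-slow (trace start i) x) (s≤s (ins≤time i x))

  ins-+ : ∀ c k i x → ins (trace c i) x ≤ ins (trace c (k + i)) x
  ins-+ c zero    i x = ℕ.≤-refl
  ins-+ c (suc k) i x = ℕ.≤-trans (ins-+ c k i x) (ins-mono (trace c (k + i)) x)

  trace-+ : ∀ c k i → trace (trace c i) k ≡ trace c (k + i)
  trace-+ c zero    i = refl
  trace-+ c (suc k) i = cong advance (trace-+ c k i)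

  -- The number of pushes climbs from 0 by steps of at most one and by position i has reached the
  -- number of pops. This supplies the past witness in `queue`.
  pushed-before : ∀ i x → ∃ λ j → j ≤ i × ins (trace start j) x ≡ outs (trace start i) x
  pushed-before i x with intermediate (λ j → ins (trace start j) x) (λ j → ins-slow (trace start j) x)
                           i 0 z≤n (subst (λ m → outs (trace start i) x ≤ ins (trace start m) x)
                                      (sym (ℕ.+-identityʳ i)) (outs≤ins i x))
  ... | j , _ , j≤ , eq = j , subst (j ≤_) (ℕ.+-identityʳ i) j≤ , eq

  module _ {t : ℕ} (dead : Dead (trace start t)) where

    private
      dead-later : ∀ k → Dead (trace start (k + t))
      dead-later zero    = dead
      dead-later (suc k) = advance-dead (dead-later k)

      ins-later : ∀ k x → ins (trace start (k + t)) x ≤ t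
      ins-later zero    x = ins≤time t x
      ins-later (suc k) x = ℕ.≤-trans (ℕ.≤-reflexive (dead-ins x (dead-later k))) (ins-later k x)

    -- No push happens after t, so finitely many data values suffice for the whole infinite model.
    ins-bounded : ∀ i x → ins (trace start i) x ≤ t
    ins-bounded i x with ℕ.≤-total i t
    ... | inj₁ i≤t = ℕ.≤-trans (ins≤time i x) i≤t
    ... | inj₂ t≤i = subst (λ j → ins (trace start j) x ≤ t) (ℕ.m∸n+n≡m t≤i) (ins-later (i ∸ t) x)

    popped-later : ∀ i x → ∃ λ j → i ≤ j × outs (trace start j) x ≡ ins (trace start i) x
    popped-later i x with intermediate (λ j → outs (trace start j) x) (λ j → outs-slow (trace start j) x)
                            -- At position `i + t` the trace is dead with a backlog of at most t,
                            -- which t further steps drain.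
                            (t + t) i (outs≤ins i x) reached
      where
      reached : ins (trace start i) x ≤ outs (trace start (t + t + i)) x
      reached = begin
        ins (trace start i) x                  ≤⟨ ins-+ start t i x ⟩
        ins (trace start (t + i)) x            ≡⟨ cong (λ j → ins (trace start j) x) (ℕ.+-comm t i) ⟩
        ins (trace start (i + t)) x            ≤⟨ dead-drains t x (dead-later i)
                                                    (ℕ.≤-trans (ins-later i x) (ℕ.m≤m+n t _)) ⟩
        outs (trace (trace start (i + t)) t) x ≡⟨ cong (λ c → outs c x) (trace-+ start t (i + t)) ⟩
        outs (trace start (t + (i + t))) x     ≡⟨ cong (λ j → outs (trace start j) x)
                                                    (trans (cong (t +_) (ℕ.+-comm i t)) (sym (ℕ.+-assoc t t i))) ⟩
        outs (trace start (t + t + i)) x       ∎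
        where open ℕ.≤-Reasoning hiding (start)
    ... | j , i≤j , _ , eq = j , i≤j , eq

-- The model read off from a trace

assign : ∀ {a} {A : Set a} → (f g h : ℕ → A) → ℕ → A
assign f g h 0                   = f 0
assign f g h 1                   = g 0
assign f g h 2                   = h 0
assign f g h (suc (suc (suc k))) = assign (f ∘ suc) (g ∘ suc) (h ∘ suc) k

module _ {a} {A : Set a} where

  assign-pushed : ∀ (f g h : ℕ → A) k → assign f g h (pushed k) ≡ f k
  assign-pushed f g h zero    = refl
  assign-pushed f g h (suc k) = assign-pushed (f ∘ suc) (g ∘ suc) (h ∘ suc) k

  assign-popped : ∀ (f g h : ℕ → A) k → assign f g h (popped k) ≡ g k
  assign-popped f g h zero    = refl
  assign-popped f g h (suc k) = assign-popped (f ∘ suc) (g ∘ suc) (h ∘ suc) k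

  assign-extra : ∀ (f g h : ℕ → A) k → assign f g h (extra k) ≡ h k
  assign-extra f g h zero    = refl
  assign-extra f g h (suc k) = assign-extra (f ∘ suc) (g ∘ suc) (h ∘ suc) k

extend : ∀ {R} → (Fin R → ℕ) → ℕ → ℕ
extend {zero}  f k       = 0
extend {suc R} f zero    = f zero
extend {suc R} f (suc k) = extend (f ∘ suc) k

extend-toℕ : ∀ {R} (f : Fin R → ℕ) x → extend f (toℕ x) ≡ f x
extend-toℕ f zero    = refl
extend-toℕ f (suc x) = extend-toℕ (f ∘ suc) x

module Completeness {a ℓ : Level} {D : Set a} {_<ᴰ_ : Rel D ℓ} (sto : IsStrictTotalOrder _≡_ _<ᴰ_)
  {R : ℕ} (P : List (Command (suc R))) (n : ℕ) where

  open Semantics D _<ᴰ_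
  open Connectives {D = D} {_<ᴰ_}
  open Trace P n
  private module O = IsStrictTotalOrder sto

  module _
    (halts : Halts start)
    (loads : ins (trace start (suc n)) zero ≡ n)
    (d : ℕ → D)
    (d-mono : ∀ {i j} → i < j → j ≤ suc (n + proj₁ (halts-dead halts)) → d i <ᴰ d j)
    where

    private
      t b : ℕ
      t = proj₁ (halts-dead halts)
      -- This bound covers the counts, at most t, the index n of the target, and the index 1 needed
      -- to tell `d 0` from `d 1`.
      b = suc (n + t)

      dead : Dead (trace start t)
      dead = proj₂ (halts-dead halts)

      C : ℕ → Conf
      C = trace start

    F G : ℕ → ℕ → D
    F i = d ∘ extend (ins (C i))
    G i = d ∘ extend (outs (C i))

    -- Follows the numbering of `extra`: the target, which is `d n` because n elements are in at
    -- position `suc n`; the reference `true`; then the states, of which only the current one equals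
    -- it.
    values : Conf → ℕ → D
    values c zero          = d n
    values c (suc zero)    = d 0
    values c (suc (suc q)) = if does (q ≟ℕ at c) then d 0 else d 1

    σ : Model
    σ i (inj₁ x) = assign (F i) (G i) (values (C i)) x
    σ i (inj₂ x) = assign (F i) (G i) (values (C i)) x

    private
      ins≤b : ∀ i x → ins (C i) x ≤ b
      ins≤b i x = ℕ.≤-trans (ins-bounded {t} dead i x) (ℕ.m≤n+m t (suc n))

      outs≤b : ∀ i x → outs (C i) x ≤ b
      outs≤b i x = ℕ.≤-trans (outs≤ins i x) (ins≤b i x)

      n≤b : n ≤ b
      n≤b = ℕ.m≤n⇒m≤1+n (ℕ.m≤m+n n t)

      d-injective : ∀ {i j} → i ≤ b → j ≤ b → d i ≡ d j → i ≡ j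
      d-injective {i} {j} i≤b j≤b eq with ℕ.<-cmp i j
      ... | tri< i<j _ _ = contradiction (d-mono i<j j≤b) (O.irrefl eq)
      ... | tri≈ _ i≡j _ = i≡j
      ... | tri> _ _ j<i = contradiction (d-mono j<i i≤b) (O.irrefl (sym eq))

      σ-pushed : ∀ i x → σ i (inj₁ (pushed (toℕ x))) ≡ d (ins (C i) x)
      σ-pushed i x = trans (assign-pushed (F i) (G i) (values (C i)) (toℕ x)) (cong d (extend-toℕ (ins (C i)) x))

      σ-popped : ∀ i x → σ i (inj₁ (popped (toℕ x))) ≡ d (outs (C i) x)
      σ-popped i x = trans (assign-popped (F i) (G i) (values (C i)) (toℕ x)) (cong d (extend-toℕ (outs (C i)) x))

      ≈-intro : ∀ i x y → σ i (inj₁ x) ≡ σ i (inj₁ y) → σ , i ⊨ x ≈X[ 0 ]ˡ y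
      ≈-intro i x y eq = lift (trans eq (sym (now σ i (inj₁ y))))

      ≈-elim : ∀ i x y → σ , i ⊨ x ≈X[ 0 ]ˡ y → σ i (inj₁ x) ≡ σ i (inj₁ y)
      ≈-elim i x y p = trans (lower p) (now σ i (inj₁ y))

      same-intro : ∀ i x → σ i (inj₁ x) ≡ σ (suc i) (inj₁ x) → σ , i ⊨ same x
      same-intro i x eq = lift (trans eq (sym (soon σ i (inj₁ x))))

      above-intro : ∀ i x → σ i (inj₁ x) <ᴰ σ (suc i) (inj₁ x) → σ , i ⊨ above x
      above-intro i x lt = lift (subst (σ i (inj₁ x) <ᴰ_) (sym (soon σ i (inj₁ x))) lt)

      state-intro : ∀ i → σ , i ⊨ state (at (C i))
      state-intro i = ≈-intro i (extra (2 + at (C i))) true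
        (trans (assign-extra (F i) (G i) (values (C i)) (2 + at (C i))) current-true)
        where
        current-true : values (C i) (2 + at (C i)) ≡ d 0
        current-true with at (C i) ≟ℕ at (C i)
        ... | yes _ = refl
        ... | no ne = contradiction refl ne

      state-elim : ∀ i q → σ , i ⊨ state q → q ≡ at (C i)
      state-elim i q p = unique
        (trans (sym (assign-extra (F i) (G i) (values (C i)) (2 + q))) (≈-elim i (extra (2 + q)) true p))
        where
        unique : values (C i) (2 + q) ≡ d 0 → q ≡ at (C i)
        unique eq with q ≟ℕ at (C i)
        ... | yes q≡ = q≡
        ... | no _   = contradiction (d-mono (s≤s z≤n) (s≤s z≤n)) (O.irrefl (sym eq))

      empty-intro : ∀ i x → ins (C i) x ≡ outs (C i) x → σ , i ⊨ empty (toℕ x)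
      empty-intro i x eq = ≈-intro i (pushed (toℕ x)) (popped (toℕ x))
        (trans (σ-pushed i x) (trans (cong d eq) (sym (σ-popped i x))))

      empty-elim : ∀ i x → σ , i ⊨ empty (toℕ x) → ins (C i) x ≡ outs (C i) x
      empty-elim i x p = d-injective (ins≤b i x) (outs≤b i x)
        (trans (sym (σ-pushed i x)) (trans (≈-elim i (pushed (toℕ x)) (popped (toℕ x)) p) (σ-popped i x)))

      full-intro : ∀ i x → ins (C i) x ≡ n → σ , i ⊨ full (toℕ x)
      full-intro i x eq = ≈-intro i (pushed (toℕ x)) target (trans (σ-pushed i x) (cong d eq))

      full-elim : ∀ i x → σ , i ⊨ full (toℕ x) → ins (C i) x ≡ n
      full-elim i x p = d-injective (ins≤b i x) n≤b
        (trans (sym (σ-pushed i x)) (≈-elim i (pushed (toℕ x)) target p))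

      same-pushed : ∀ i x → ins (C (suc i)) x ≡ ins (C i) x → σ , i ⊨ same (pushed (toℕ x))
      same-pushed i x eq = same-intro i (pushed (toℕ x))
        (trans (σ-pushed i x) (trans (cong d (sym eq)) (sym (σ-pushed (suc i) x))))

      same-popped : ∀ i x → outs (C (suc i)) x ≡ outs (C i) x → σ , i ⊨ same (popped (toℕ x))
      same-popped i x eq = same-intro i (popped (toℕ x))
        (trans (σ-popped i x) (trans (cong d (sym eq)) (sym (σ-popped (suc i) x))))

      above-pushed : ∀ i x → ins (C (suc i)) x ≡ suc (ins (C i) x) → σ , i ⊨ above (pushed (toℕ x))
      above-pushed i x eq = above-intro i (pushed (toℕ x))
        (subst₂ _<ᴰ_ (sym (σ-pushed i x)) (sym (σ-pushed (suc i) x))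
        (d-mono (ℕ.≤-reflexive (sym eq)) (ins≤b (suc i) x)))

      above-popped : ∀ i x → outs (C (suc i)) x ≡ suc (outs (C i) x) → σ , i ⊨ above (popped (toℕ x))
      above-popped i x eq = above-intro i (popped (toℕ x))
        (subst₂ _<ᴰ_ (sym (σ-popped i x)) (sym (σ-popped (suc i) x))
        (d-mono (ℕ.≤-reflexive (sym eq)) (outs≤b (suc i) x)))

      actions : ℕ → Fin (suc R) → Action
      actions i = proj₁ (current (C i))

      act-holds : ∀ i x → σ , i ⊨ act (actions i x) (toℕ x)
      act-holds i x with actions i x in eq
      ... | push = above-pushed i x (cong (λ f → pushes f (ins (C i) x)) eq)
                 , same-popped i x (cong (λ f → pops f (outs (C i) x)) eq)
      ... | pop  = same-pushed i x (cong (λ f → pushes f (ins (C i) x)) eq)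
                 , above-popped i x (cong (λ f → pops f (outs (C i) x)) eq)
      ... | keep = same-pushed i x (cong (λ f → pushes f (ins (C i) x)) eq)
                 , same-popped i x (cong (λ f → pops f (outs (C i) x)) eq)

      move-holds : ∀ i {cmd p} → fetch P (at (C i)) ≡ cmd → plan cmd (C i) ≡ p →
                   σ , i ⊨ move (proj₁ p) (proj₂ p)
      move-holds i f eq =
        subst (λ p → σ , i ⊨ move (proj₁ p) (proj₂ p)) (trans (cong (λ cmd → plan cmd (C i)) f) eq)
          (⋀-intro σ (λ x → act (actions i x) (toℕ x)) (act-holds i) , state-intro (suc i))

      effect-holds : ∀ i cmd → fetch P (at (C i)) ≡ cmd → σ , i ⊨ effect (at (C i)) cmd
      effect-holds i (incr r k)    f = move-holds i f refl
      effect-holds i (decr r k k') f =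
        (λ (p , ¬m) → ¬m (move-holds i f (plan-decr₀ (C i) r k k' (empty-elim i r p)))) ,
        (λ (p , ¬m) → ¬m (move-holds i f (plan-decr₊ (C i) r k k' (p ∘ empty-intro i r))))
      effect-holds i (load r k)    f =
        (λ (p , ¬m) → ¬m (move-holds i f (plan-load₌ (C i) r k (full-elim i r p)))) ,
        (λ (p , ¬m) → ¬m (move-holds i f (plan-load₁ (C i) r k (p ∘ full-intro i r))))
      effect-holds i (stop r)      f = empty-intro i r (halts-output halts i f)
      effect-holds i idle          f = ⊤-intro σ {i}

      rising : ∀ i k f → σ , i ⊨ act f k →
               (σ , i ⊨ above (pushed k) ∨' same (pushed k)) × (σ , i ⊨ above (popped k) ∨' same (popped k))
      rising i k push (p , q) = (λ (np , _) → np p) , (λ (_ , nq) → nq q)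
      rising i k pop  (p , q) = (λ (_ , np) → np p) , (λ (nq , _) → nq q)
      rising i k keep (p , q) = (λ (_ , np) → np p) , (λ (_ , nq) → nq q)

      queue-holds : ∀ i x → σ , i ⊨ queue (pushed (toℕ x)) (popped (toℕ x))
      queue-holds i x with rising i (toℕ x) (actions i x) (act-holds i x)
      ... | up-h , up-l = (lift refl , lift refl) , up-h , up-l , later , before
        where
        later : σ , i ⊨ pushed (toℕ x) ≈X[ 0 ]ˡ popped (toℕ x) ∨' pushed (toℕ x) ≈XFʳ popped (toℕ x)
        later (now≢ , fut≢) with popped-later {t} dead i x
        -- The future operator is strict, so j = i is left to the disjunct about the present
        -- position.
        ... | j , i≤j , eq with ℕ.m≤n⇒m<n∨m≡n i≤j
        ...   | inj₁ i<j  = fut≢ (lift (j , i<j ,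
          trans (σ-pushed i x) (trans (cong d (sym eq)) (sym (σ-popped j x)))))
        ...   | inj₂ refl = now≢ (empty-intro i x (sym eq))
        before : σ , i ⊨ popped (toℕ x) ≈X[ 0 ]ˡ pushed (toℕ x) ∨' popped (toℕ x) ≈XF⁻¹ʳ pushed (toℕ x)
        before (now≢ , past≢) with pushed-before i x
        ... | j , j≤i , eq with ℕ.m≤n⇒m<n∨m≡n j≤i
        ...   | inj₁ j<i  = past≢ (lift (j , j<i ,
          trans (σ-popped i x) (trans (cong d (sym eq)) (sym (σ-pushed j x)))))
        ...   | inj₂ refl = now≢ (≈-intro i (popped (toℕ x)) (pushed (toℕ x))
          (trans (σ-popped i x) (trans (cong d (sym eq)) (sym (σ-pushed i x)))))

      always-holds : ∀ i → σ , i ⊨ always P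
      always-holds i =
        same-intro i target refl ,
        ⋀-intro σ (λ x → queue (pushed (toℕ x)) (popped (toℕ x))) (queue-holds i) ,
        rules-intro σ 0 P λ q s → subst (λ p → σ , i ⊨ effect p (fetch P q)) (sym (ℕ.+-identityʳ q))
          (fires q (state-elim i (q + 0) s))
        where
        fires : ∀ q → q + 0 ≡ at (C i) → σ , i ⊨ effect q (fetch P q)
        fires q eq with refl ← trans (sym (ℕ.+-identityʳ q)) eq = effect-holds i _ refl

    satisfied : σ , 0 ⊨ computation P ∧' numeral (suc n)
    satisfied =
      ((state-intro 0 , ⋀-intro σ (λ (x : Fin (suc R)) → empty (toℕ x)) (λ x → empty-intro 0 x refl)) ,
       □-intro σ (always P) always-holds) ,
      lift (sym (trans (σ-pushed (suc n) zero) (cong d loads)))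

-- The loading phase of a trace

module LoadingComplete {r : ℕ} {P : List (Command (6 + r))}
  (at₀ : fetch P 0 ≡ incr #j 1) (at₁ : fetch P 1 ≡ load #n 2) (n : ℕ) where

  open Trace P n

  private
    advance-push : ∀ c v r {cmd q k} → fetch P q ≡ cmd → plan cmd c ≡ (only r push , k) →
                   Represents c q v → Represents (advance c) k (v [ r ]%= suc)
    advance-push c v r {k = k} f eq rep@(refl , _) =
      subst (λ c → Represents c k (v [ r ]%= suc)) (sym (current-≡ c f eq)) (apply-push c v r rep)

    -- `Represents` fixes only the difference of pushes and pops, whereas the load test reads the
    -- pushes alone; hence the second component.
    loading : ∀ i → i ≤ n → Represents (trace start (suc i)) 1 (loaded i) × outs (trace start (suc i)) zero ≡ 0
    loading zero    _   =
      advance-push start (replicate (6 + r) 0) #j at₀ refl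
        (refl , λ x → sym (trans (ℕ.+-identityʳ _) (lookup-replicate x 0))) ,
      cong (λ cmd → pops (proj₁ (plan cmd start) zero) 0) at₀
    loading (suc i) i<n with loading i (ℕ.<⇒≤ i<n)
    ... | rep@(at≡ , eq) , none =
      advance-push c (loaded i) #n at₁ (trans (plan-load₁ c #n 2 early) (cong (only #n push ,_) at≡)) rep ,
      trans (cong (λ c → outs c zero) (current-≡ c (trans (cong (fetch P) at≡) at₁) refl)) none
      where
      c = trace start (suc i)
      early : ins c zero ≢ n
      early full = ℕ.<⇒≢ i<n (trans (sym (trans (eq zero) (trans (cong (i +_) none) (ℕ.+-identityʳ i)))) full)

  loads : ins (trace start (suc n)) zero ≡ n
  loads with loading n ℕ.≤-refl
  ... | (_ , eq) , none = trans (eq zero) (trans (cong (n +_) none) (ℕ.+-identityʳ n))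

  run-halts-start : Run P 0 2 (loaded (suc n)) → Halts start
  run-halts-start run = running (λ _ → not-stop at₀ λ ()) (back n ℕ.≤-refl exit)
    where
    exit : Halts (trace start (suc n))
    exit with loading n ℕ.≤-refl
    ... | rep@(at≡ , _) , _ = running (λ _ → not-stop (trans (cong (fetch P) at≡) at₁) λ ())
      (run-halts run (advance-push (trace start (suc n)) (loaded n) #n at₁
        (plan-load₌ (trace start (suc n)) #n 2 loads) rep))
    back : ∀ i → i ≤ n → Halts (trace start (suc i)) → Halts (trace start 1)
    back zero    _   h = h
    back (suc i) i<n h = back i (ℕ.<⇒≤ i<n)
      (running (λ _ → not-stop (trans (cong (fetch P) (proj₁ (proj₁ (loading i (ℕ.<⇒≤ i<n))))) at₁) λ ()) h)

code-diagonal : ∀ φ {n ψ} → n ≡ code φ → φ ∧' numeral n ≡ ψ → code ψ ≡ diagonalCode n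
code-diagonal φ refl refl = diagonalCode-≡ (code φ)

abstract
  -- A code is a power of two times an odd number. Positivity matters since loading makes at least
  -- one push.
  code-positive : ∀ φ → ∃ λ n → suc n ≡ code φ
  code-positive φ with code φ in eq
  ... | suc n = n , refl
  ... | zero  with ℕ.m*n≡0⇒m≡0∨n≡0 (2 ^ tag φ) eq
  ...   | inj₁ p with () ← ℕ.m^n≡0⇒m≡0 2 (tag φ) p

-- Diagonalisation

module Refutation {a ℓ : Level} {D : Set a} {_<ᴰ_ : Rel D ℓ} (sto : IsStrictTotalOrder _≡_ _<ᴰ_)
  (infinite : Infinite D) {r : ℕ} (P : List (Command (6 + r)))
  (at₀ : fetch P 0 ≡ incr #j 1) (at₁ : fetch P 1 ≡ load #n 2) where

  private
    Sat : Formula → Set (a Level.⊔ ℓ)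
    Sat = Satisfiable D _<ᴰ_

  positive-unsatisfiable : ∀ n {o} → Run P (suc o) 2 (loaded (suc n)) →
                           ¬ Sat (computation P ∧' numeral (suc n))
  positive-unsatisfiable n run (σ , sat) =
    LoadingSound.no-positive-output sto {P = P} at₀ at₁ {σ} {n} sat run

  -- The chain of data values exists only up to double negation, and so does the model; this
  -- suffices for a contradiction.
  zero-satisfiable : ∀ n → Run P 0 2 (loaded (suc n)) → ¬ ¬ Sat (computation P ∧' numeral (suc n))
  zero-satisfiable n run unsat = Chains.chain sto infinite _ λ (d , d-mono) →
    unsat (_ , Completeness.satisfied sto P n (LoadingComplete.run-halts-start at₀ at₁ n run)
                 (LoadingComplete.loads {P = P} at₀ at₁ n) d d-mono)

  -- If ψ were satisfiable, M would output 1 and thereby refute ψ. So ψ is unsatisfiable and M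
  -- outputs 0, which cannot leave ψ unsatisfiable.
  not-decided : ∀ (M : Machine) → (∀ n o → M ⟨ diagonalCode n ⟩⇓ o → Run P o 2 (loaded n)) →
    ∀ {n ψ} → suc n ≡ code (computation P) → computation P ∧' numeral (suc n) ≡ ψ →
    ¬ (∀ φ → (Sat φ → M ⟨ code φ ⟩⇓ 1) × (¬ Sat φ → M ⟨ code φ ⟩⇓ 0))
  not-decided M simulate {n} {ψ} n-code ψ-def decides =
    zero-satisfiable n (run 0 (proj₂ (decides ψ) unsatisfiable)) (unsatisfiable ∘ subst Sat ψ-def)
    where
    run : ∀ o → M ⟨ code ψ ⟩⇓ o → Run P o 2 (loaded (suc n))
    run o M⇓ = simulate (suc n) o
      (subst (λ k → M ⟨ k ⟩⇓ o) (code-diagonal (computation P) n-code ψ-def) M⇓)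

    unsatisfiable : ¬ Sat ψ
    unsatisfiable sat =
      positive-unsatisfiable n {0} (run 1 (proj₁ (decides ψ) sat)) (subst Sat (sym ψ-def) sat)

DiagonalSimulation : Machine → Set
DiagonalSimulation M = ∃ λ (P : List (Command (6 + Machine.r M))) →
    fetch P 0 ≡ incr #j 1 × fetch P 1 ≡ load #n 2 ×
    (∀ n o → M ⟨ diagonalCode n ⟩⇓ o → Run P o 2 (loaded n))

abstract
  diagonal-simulation : ∀ M → DiagonalSimulation M
  diagonal-simulation M = P , refl , refl , λ n o → simulate-diagonal {n} {o}
    where open Simulation M

theorem3p2p1 : {a ℓ : Level} (D : Set a) (_<ᴰ_ : Rel D ℓ) →
    IsStrictTotalOrder _≡_ _<ᴰ_ →
    Infinite D →
    Undecidable code (Satisfiable D _<ᴰ_)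
theorem3p2p1 D _<ᴰ_ sto infinite (M , decides) = refute (diagonal-simulation M)
  where
  refute : ¬ DiagonalSimulation M
  refute (P , at₀ , at₁ , simulate) =
    Refutation.not-decided sto infinite P at₀ at₁ M simulate {n} {computation P ∧' numeral (suc n)}
      (proj₂ (code-positive (computation P))) refl decides
    where
    n : ℕ
    n = proj₁ (code-positive (computation P))
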